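{- If $G$ is a cubic graph of order $n$, then $\gamma_r(G) \le \frac{2}{5}n$.
   Context: All graphs are finite and simple. A cubic graph is a graph in which every vertex has degree $3$. A restrained dominating set of a graph $G$ is a set $S\subseteq V(G)$ such that every vertex not in $S$ has a neighbor in $S$ and also has a neighbor not in $S$. The restrained domination number $\gamma_r(G)$ is the minimum cardinality of a restrained dominating set of $G$. -}

module Defs where

open import Data.Nat using (ℕ)
open import Data.Bool using (Bool; true; false)
open import Data.Fin using (Fin)
open import Data.Fin.Subset using (Subset; _∈_; _∉_; ∣_∣)
open import Data.Vec using (tabulate)
open import Data.Product using (∃-syntax; _×_)
open import Relation.Binary.PropositionalEquality using (_≡_)
open import Relation.Nullary using (¬_)

record Graph (n : ℕ) : Set where
  field
    adj   : Fin n → Fin n → Bool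
    sym   : ∀ u v → adj u v ≡ adj v u
    irrefl : ∀ v → adj v v ≡ false

open Graph public

Adj : ∀ {n} → Graph n → Fin n → Fin n → Set
Adj G u v = adj G u v ≡ true

nbhd : ∀ {n} → Graph n → Fin n → Subset n
nbhd G v = tabulate (adj G v)

degree : ∀ {n} → Graph n → Fin n → ℕ
degree G v = ∣ nbhd G v ∣

Cubic : ∀ {n} → Graph n → Set
Cubic G = ∀ v → degree G v ≡ 3

IsRestrainedDominating : ∀ {n} → Graph n → Subset n → Set
IsRestrainedDominating {n} G S =
  ∀ v → v ∉ S →
    (∃[ u ] (Adj G v u × u ∈ S)) × (∃[ w ] (Adj G v w × w ∉ S))

{-# OPTIONS --safe #-}
module Submission where

-- Build D greedily.  A state marks every vertex undecided (𝕌), in D (𝕊) or outside D (𝕋), where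
-- each 𝕋-vertex already has an 𝕊-neighbour and a 𝕋-neighbour.  Give an undecided vertex with s
-- 𝕊-neighbours and t 𝕋-neighbours a weight w(s,t), an 𝕋-vertex 80 and an 𝕊-vertex 0; the sum is
-- 48n at the start and 80(n − |D|) at the end, so it suffices that it never decreases.
--
-- As long as some undecided vertex has a decided neighbour, a few vertices around it can be decided
-- at no loss.  This is a finite case distinction on the neighbourhood of a vertex of the first
-- type occurring in a fixed priority order, coincidences included; the case trees were found
-- by computer search and are checked by evaluation.  If the undecided vertices have no decided
-- neighbour, a step may lose 15; but the potential is then a multiple of 16, as is 48n, so
-- "potential + 15 ≥ 48n" is an invariant.

open import Defs
import Algebra.Properties.CommutativeSemigroup as CommutativeSemigroup
open import Data.Bool using (Bool; true; false)
import Data.Bool.Properties as Bool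
open import Data.Empty using (⊥)
open import Data.Fin using (Fin; zero; suc)
import Data.Fin.Properties as Fin
open import Data.Fin.Subset using (Subset; ∣_∣)
import Data.Fin.Subset as Subset
open import Data.List using (List; []; _∷_; _++_; length; map; filter; upTo; allFin; tabulate)
open import Data.List.Membership.Propositional using (_∈_; _∉_; find)
open import Data.List.Membership.Propositional.Properties
import Data.List.Membership.DecPropositional as DecMembership
open import Data.List.Properties using (length-map; length-++; map-cong-local; map-∘; filter-none)
open import Data.List.Relation.Unary.All as All using (All; []; _∷_)
import Data.List.Relation.Unary.All.Properties as All
open import Data.List.Relation.Unary.AllPairs using ([]; _∷_)
open import Data.List.Relation.Unary.Any as Any using (Any; here; there)
open import Data.List.Relation.Unary.Unique.Propositional using (Unique)
import Data.List.Relation.Unary.Unique.Propositional.Properties as Unique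
open import Data.Nat
open import Data.Nat.Induction using (<-wellFounded)
open import Data.Nat.ListAction using (sum)
open import Data.Nat.Properties
open import Data.List.Relation.Unary.Unique.DecPropositional _≟_ using (unique?)
open CommutativeSemigroup +-commutativeSemigroup using (interchange; xy∙z≈xz∙y)
open import Data.Product using (∃-syntax; _×_; _,_; proj₁; proj₂)
open import Data.Product.Properties using (≡-dec)
open import Data.Sum using (_⊎_; inj₁; inj₂)
open import Data.Unit using (⊤; tt)
import Data.Vec as Vec
import Data.Vec.Properties as Vec
open import Function using (_∘_; id)
open import Induction.WellFounded using (Acc; acc)
open import Relation.Binary.Definitions using (DecidableEquality)
open import Relation.Binary.PropositionalEquality renaming (sym to ≡-sym)
open import Relation.Nullary using (¬_; Dec; yes; no; does; contradiction)
open import Relation.Nullary.Decidable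
  using (_×-dec_; _⊎-dec_; _→-dec_; ¬?; toWitness; toSum; dec-true)

private
  variable
    A : Set

-- Lists without repetitions

remove : {x : A} (ys : List A) → x ∈ ys →
  ∃[ zs ] length ys ≡ suc (length zs) × (∀ {y} → y ∈ ys → y ≢ x → y ∈ zs)
remove (_ ∷ ys) (here refl) = ys , refl , λ where
  (here y≡x)  y≢x → contradiction y≡x y≢x
  (there y∈ys) _  → y∈ys
remove (y ∷ ys) (there x∈ys) with zs , eq , rest ← remove ys x∈ys =
  y ∷ zs , cong suc eq , λ where
    (here y≡)     _   → here y≡
    (there y′∈ys) y≢x → there (rest y′∈ys y≢x)

unique-⊆⇒length-≤ : {xs ys : List A} → Unique xs → (∀ {x} → x ∈ xs → x ∈ ys) →
  length xs ≤ length ys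
unique-⊆⇒length-≤ [] sub = z≤n
unique-⊆⇒length-≤ {ys = ys} (x∉xs ∷ uniq) sub with zs , eq , rest ← remove ys (sub (here refl)) =
  subst (_ ≤_) (≡-sym eq)
    (s≤s (unique-⊆⇒length-≤ uniq λ y∈xs →
      rest (sub (there y∈xs)) λ y≡x → All.lookup x∉xs y∈xs (≡-sym y≡x)))

unique-⇔⇒length-≡ : {xs ys : List A} → Unique xs → Unique ys →
  (∀ {x} → x ∈ xs → x ∈ ys) → (∀ {x} → x ∈ ys → x ∈ xs) → length xs ≡ length ys
unique-⇔⇒length-≡ ux uy sub sup =
  ≤-antisym (unique-⊆⇒length-≤ ux sub) (unique-⊆⇒length-≤ uy sup)

module _ (_≟ᴬ_ : DecidableEquality A) where
  open DecMembership _≟ᴬ_ using (_∈?_)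

  unique-longer⇒∃∉ : {xs ys : List A} → Unique xs → length ys < length xs →
    ∃[ x ] x ∈ xs × x ∉ ys
  unique-longer⇒∃∉ {xs} {ys} uniq longer with All.all? (_∈? ys) xs
  ... | yes xs⊆ys = contradiction (unique-⊆⇒length-≤ uniq (All.lookup xs⊆ys)) (<⇒≱ longer)
  ... | no  xs⊈ys = let x , x∈xs , x∉ys = find (All.¬All⇒Any¬ (_∈? ys) xs xs⊈ys) in x , x∈xs , x∉ys

  -- A `y` of `ys` missing from `xs` would make `y ∷ xs` a repetition-free list inside `ys` that is
  -- longer than `ys`.
  unique-⊆-short⇒⊇ : {xs ys : List A} → Unique xs → (∀ {x} → x ∈ xs → x ∈ ys) →
    length ys ≤ length xs → ∀ {y} → y ∈ ys → y ∈ xs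
  unique-⊆-short⇒⊇ {xs} uniq sub short {y} y∈ys with y ∈? xs
  ... | yes y∈xs = y∈xs
  ... | no  y∉xs = contradiction (≤-trans (unique-⊆⇒length-≤ uniq′ sub′) short) (<-irrefl refl)
    where
    uniq′ = All.tabulate (λ x∈xs y≡x → y∉xs (subst (_∈ xs) (≡-sym y≡x) x∈xs)) ∷ uniq
    sub′ : ∀ {x} → x ∈ y ∷ xs → x ∈ _
    sub′ (here refl)  = y∈ys
    sub′ (there x∈xs) = sub x∈xs

map-unique : {B : Set} {f : A → B} {xs : List A} →
  (∀ {x y} → x ∈ xs → y ∈ xs → f x ≡ f y → x ≡ y) → Unique xs → Unique (map f xs)
map-unique inj [] = []
map-unique inj (x∉xs ∷ uniq) =
  All.map⁺ (All.tabulate λ y∈xs fx≡fy → All.lookup x∉xs y∈xs (inj (here refl) (there y∈xs) fx≡fy))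
  ∷ map-unique (λ x∈ y∈ → inj (there x∈) (there y∈)) uniq

-- Sums over all vertices

∑ : ∀ {n} → (Fin n → ℕ) → ℕ
∑ {zero}  f = 0
∑ {suc n} f = f zero + ∑ (f ∘ suc)

∑-cong : ∀ {n} {f g : Fin n → ℕ} → (∀ v → f v ≡ g v) → ∑ f ≡ ∑ g
∑-cong {zero}  eq = refl
∑-cong {suc n} eq = cong₂ _+_ (eq zero) (∑-cong (eq ∘ suc))

∑-const : ∀ n k → ∑ {n} (λ _ → k) ≡ n * k
∑-const zero    k = refl
∑-const (suc n) k = cong (k +_) (∑-const n k)

∑-+ : ∀ {n} (f g : Fin n → ℕ) → ∑ (λ v → f v + g v) ≡ ∑ f + ∑ g
∑-+ {zero}  f g = refl
∑-+ {suc n} f g = begin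
  (f zero + g zero) + ∑ (λ v → f (suc v) + g (suc v)) ≡⟨ cong ((f zero + g zero) +_) (∑-+ (f ∘ suc) (g ∘ suc)) ⟩
  (f zero + g zero) + (∑ (f ∘ suc) + ∑ (g ∘ suc))     ≡⟨ interchange (f zero) (g zero) _ _ ⟩
  (f zero + ∑ (f ∘ suc)) + (g zero + ∑ (g ∘ suc))     ∎
  where
  open ≡-Reasoning

∑-* : ∀ {n} k (f : Fin n → ℕ) → ∑ (λ v → k * f v) ≡ k * ∑ f
∑-* {zero}  k f = ≡-sym (*-zeroʳ k)
∑-* {suc n} k f = trans (cong (k * f zero +_) (∑-* k (f ∘ suc))) (≡-sym (*-distribˡ-+ k (f zero) _))

∑-mono-≤ : ∀ {n} {f g : Fin n → ℕ} → (∀ v → f v ≤ g v) → ∑ f ≤ ∑ g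
∑-mono-≤ {zero}  le = z≤n
∑-mono-≤ {suc n} le = +-mono-≤ (le zero) (∑-mono-≤ (le ∘ suc))

∑-mono-< : ∀ {n} {f g : Fin n → ℕ} → (∀ v → f v ≤ g v) → ∀ u → f u < g u → ∑ f < ∑ g
∑-mono-< le zero    lt = +-mono-<-≤ lt (∑-mono-≤ (le ∘ suc))
∑-mono-< le (suc u) lt = +-mono-≤-< (le zero) (∑-mono-< (le ∘ suc) u lt)

∑-exchange₁ : ∀ {n} {f g : Fin n → ℕ} u → (∀ v → v ≢ u → f v ≡ g v) → ∑ f + g u ≡ ∑ g + f u
∑-exchange₁ {suc n} {f} {g} zero agree
  rewrite ∑-cong {f = f ∘ suc} {g = g ∘ suc} (λ v → agree (suc v) λ ()) =
  trans (+-assoc (f zero) _ (g zero)) (trans (+-comm (f zero) _) (cong (_+ f zero) (+-comm _ (g zero))))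
∑-exchange₁ {suc n} {f} {g} (suc u) agree
  rewrite agree zero (λ ()) | +-assoc (g zero) (∑ (f ∘ suc)) (g (suc u))
        | ∑-exchange₁ {f = f ∘ suc} {g = g ∘ suc} u (λ v v≢u → agree (suc v) (v≢u ∘ Fin.suc-injective)) =
  ≡-sym (+-assoc (g zero) _ _)

-- The two sums differ by the contribution of `vs` alone; additions on both sides avoid truncated
-- subtraction. The induction passes from `f` to `g` one vertex at a time, through `h`, which is
-- already `g` at `u` and still `f` elsewhere.
∑-exchange : ∀ {n} {f g : Fin n → ℕ} {vs : List (Fin n)} → Unique vs →
  (∀ v → v ∉ vs → f v ≡ g v) → ∑ f + sum (map g vs) ≡ ∑ g + sum (map f vs)
∑-exchange [] agree = cong (_+ 0) (∑-cong λ v → agree v λ ())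
∑-exchange {n} {f} {g} {u ∷ vs} (u∉vs ∷ uniq) agree = begin
  ∑ f + (g u + sum (map g vs))   ≡⟨ ≡-sym (+-assoc (∑ f) _ _) ⟩
  (∑ f + g u) + sum (map g vs)   ≡⟨ cong (λ x → (∑ f + x) + sum (map g vs)) (≡-sym h-u) ⟩
  (∑ f + h u) + sum (map g vs)   ≡⟨ cong (_+ sum (map g vs)) (∑-exchange₁ u λ v v≢u → ≡-sym (h-other v v≢u)) ⟩
  (∑ h + f u) + sum (map g vs)   ≡⟨ xy∙z≈xz∙y (∑ h) (f u) _ ⟩
  (∑ h + sum (map g vs)) + f u   ≡⟨ cong (_+ f u) (∑-exchange uniq h-agree) ⟩
  (∑ g + sum (map h vs)) + f u   ≡⟨ cong (λ x → (∑ g + sum x) + f u) (map-cong-local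
                                      (All.tabulate λ {v} v∈vs → h-other v λ v≡u → All.lookup u∉vs v∈vs (≡-sym v≡u))) ⟩
  (∑ g + sum (map f vs)) + f u   ≡⟨ trans (+-assoc (∑ g) _ _) (cong (∑ g +_) (+-comm _ (f u))) ⟩
  ∑ g + (f u + sum (map f vs))   ∎
  where
  open ≡-Reasoning
  h : Fin n → ℕ
  h v with v Fin.≟ u
  ... | yes _ = g v
  ... | no  _ = f v
  h-u : h u ≡ g u
  h-u with u Fin.≟ u
  ... | yes _   = refl
  ... | no  u≢u = contradiction refl u≢u
  h-other : ∀ v → v ≢ u → h v ≡ f v
  h-other v v≢u with v Fin.≟ u
  ... | yes v≡u = contradiction v≡u v≢u
  ... | no  _   = refl
  h-agree : ∀ v → v ∉ vs → h v ≡ g v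
  h-agree v v∉vs with v Fin.≟ u
  ... | yes _   = refl
  ... | no  v≢u = agree v λ where
    (here v≡u)   → v≢u v≡u
    (there v∈vs) → v∉vs v∈vs

-- States and potential

data Status : Set where
  𝕌 𝕊 𝕋 : Status

_≟ˢ_ : DecidableEquality Status
𝕌 ≟ˢ 𝕌 = yes refl
𝕌 ≟ˢ 𝕊 = no λ ()
𝕌 ≟ˢ 𝕋 = no λ ()
𝕊 ≟ˢ 𝕌 = no λ ()
𝕊 ≟ˢ 𝕊 = yes refl
𝕊 ≟ˢ 𝕋 = no λ ()
𝕋 ≟ˢ 𝕌 = no λ ()
𝕋 ≟ˢ 𝕊 = no λ ()
𝕋 ≟ˢ 𝕋 = yes refl

-- The type of a vertex: its numbers of 𝕊- and 𝕋-neighbours.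
Type : Set
Type = ℕ × ℕ

-- An undecided vertex of type (3 , 0) or (0 , 3) can only join D, one of type (2 , 1) or (1 , 2) stays
-- outside at once.  The other values are scaled by 80 and solve the system of linear inequalities
-- given by the case trees below.
weight : ℕ → ℕ → ℕ
weight 0 0 = 48
weight 1 0 = 57
weight 0 1 = 39
weight 2 0 = 41
weight 1 1 = 60
weight 0 2 = 20
weight 2 1 = 80
weight 1 2 = 80
weight _ _ = 0

value : Status → ℕ → ℕ → ℕ
value 𝕌 s t = weight s t
value 𝕊 _ _ = 0
value 𝕋 _ _ = 80

-- Configurations and certificates

-- What is known about some undecided vertices, which are named 0, …, size − 1: their types, edges and
-- non-edges among them, and for each the possible types of its neighbours that are not yet
-- known (avail).
record Config : Set where
  constructor config
  field
    size  : ℕ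
    type  : ℕ → Type
    edges : List (ℕ × ℕ)
    apart : List (ℕ × ℕ)
    avail : ℕ → List Type
open Config

-- Exploration records an edge in one orientation only, hence the search in both components.
neighbours : List (ℕ × ℕ) → ℕ → List ℕ
neighbours es i = map proj₂ (filter (λ e → proj₁ e ≟ i) es) ++ map proj₁ (filter (λ e → proj₂ e ≟ i) es)

nb : Config → ℕ → List ℕ
nb C = neighbours (edges C)

deg : Config → ℕ → ℕ
deg C i = proj₁ (type C i) + proj₂ (type C i) + length (nb C i)

_[_≔_] : (ℕ → A) → ℕ → A → ℕ → A
(f [ k ≔ a ]) i with i ≟ k
... | yes _ = a
... | no  _ = f i

link : Config → ℕ → ℕ → Config
link (config m τ es as av) y z = config m τ ((y , z) ∷ es) as av

separate : Config → ℕ → ℕ → Config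
separate (config m τ es as av) y z = config m τ es ((y , z) ∷ as) av

-- Recorded neighbours without repetition stand for distinct vertices, so a cubic graph never
-- realises this situation.
Overfull : Config → ℕ → Set
Overfull C i = 3 < deg C i × Unique (nb C i)

overfull? : ∀ C i → Dec (Overfull C i)
overfull? C i = 3 <? deg C i ×-dec unique? (nb C i)

module ℕ∈ = DecMembership _≟_

_≟ᵖ_ : DecidableEquality (ℕ × ℕ)
_≟ᵖ_ = ≡-dec _≟_ _≟_

module Pair∈ = DecMembership _≟ᵖ_

Linkable : Config → ℕ → ℕ → Set
Linkable C y z = z ≢ y × z ∉ nb C y × (y , z) ∉ apart C × (z , y) ∉ apart C × ¬ Overfull (link C y z) z

linkable? : ∀ C y z → Dec (Linkable C y z)
linkable? C y z = ¬? (z ≟ y) ×-dec ¬? (z ℕ∈.∈? nb C y)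
  ×-dec ¬? ((y , z) Pair∈.∈? apart C) ×-dec ¬? ((z , y) Pair∈.∈? apart C)
  ×-dec ¬? (overfull? (link C y z) z)

-- Exploring one more undecided neighbour of y: it is the first named vertex z that is adjacent to y by
-- an unknown edge, or else a new vertex whose type is the first one realised in avail y.  Recording
-- what has been ruled out avoids considering the neighbours of y in different orders.
module Children (types : List Type) where

  -- The type `t` stays available at `y`, because a further neighbour may share it; the types listed
  -- before `t` are gone, as no unexplored neighbour of `y` has them. The new vertex `m` starts with
  -- all of `types`.
  grow : Config → ℕ → Type → List Type → Config
  grow (config m τ es as av) y t ts =
    config (suc m) (τ [ m ≔ t ]) ((y , m) ∷ es) as ((av [ y ≔ t ∷ ts ]) [ m ≔ types ])

  growths : Config → ℕ → List Type → List Config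
  growths C y []       = []
  growths C y (t ∷ ts) = grow C y t ts ∷ growths C y ts

  offspring : Config → ℕ → List ℕ → List Config
  offspring C y []       = growths C y (avail C y)
  offspring C y (z ∷ zs) = link C y z ∷ offspring (separate C y z) y zs

  children : Config → ℕ → List Config
  children C y = offspring C y (filter (linkable? C y) (upTo (size C)))

-- Base 3, least significant digit first, so that one number encodes a whole assignment; names
-- beyond its last digit stay `𝕌`.
digit : ℕ → ℕ → Status
digit k zero with k % 3
... | 0 = 𝕌
... | 1 = 𝕊
... | _ = 𝕋
digit k (suc i) = digit (k / 3) i

-- decide k gives the vertex named i the status digit k i; expand y branches over the possibilities for one
-- more neighbour of y.
data Cert : Set where
  decide : ℕ → Cert
  expand : ℕ → List Cert → Cert

hits : Config → (ℕ → Status) → Status → ℕ → ℕ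
hits C a σ i = length (filter (λ j → a j ≟ˢ σ) (nb C i))

newValue : Config → (ℕ → Status) → ℕ → ℕ
newValue C a i = value (a i) (proj₁ (type C i) + hits C a 𝕊 i) (proj₂ (type C i) + hits C a 𝕋 i)

oldValue : Config → ℕ → ℕ
oldValue C i = weight (proj₁ (type C i)) (proj₂ (type C i))

-- deg C i ≡ 3 says that all neighbours of i are known, so the effect of deciding i is known exactly.
Sound : Config → (ℕ → Status) → ℕ → Set
Sound C a i = Unique (nb C i)
  × (a i ≢ 𝕌 → deg C i ≡ 3)
  × (a i ≡ 𝕋 → (0 < proj₁ (type C i) ⊎ Any (λ j → a j ≡ 𝕊) (nb C i))
             × (0 < proj₂ (type C i) ⊎ Any (λ j → a j ≡ 𝕋) (nb C i)))

sound? : ∀ C a i → Dec (Sound C a i)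
sound? C a i = unique? (nb C i)
  ×-dec (¬? (a i ≟ˢ 𝕌) →-dec deg C i ≟ 3)
  ×-dec (a i ≟ˢ 𝕋 →-dec (0 <? proj₁ (type C i) ⊎-dec Any.any? (λ j → a j ≟ˢ 𝕊) (nb C i))
                  ×-dec (0 <? proj₂ (type C i) ⊎-dec Any.any? (λ j → a j ≟ˢ 𝕋) (nb C i)))

module Certificates (loss : ℕ) (types : List Type) where
  open Children types

  -- The `Any` clause guarantees progress. Comparing values on the named vertices suffices, since
  -- `Sound` confines the effect of the decision to them.
  Decides : Config → (ℕ → Status) → Set
  Decides C a = All (Sound C a) (upTo (size C))
    × Any (λ i → a i ≢ 𝕌) (upTo (size C))
    × sum (map (oldValue C) (upTo (size C))) ≤ loss + sum (map (newValue C a) (upTo (size C)))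

  decides? : ∀ C a → Dec (Decides C a)
  decides? C a = All.all? (sound? C a) (upTo (size C))
    ×-dec Any.any? (λ i → ¬? (a i ≟ˢ 𝕌)) (upTo (size C))
    ×-dec sum (map (oldValue C) (upTo (size C))) ≤? loss + sum (map (newValue C a) (upTo (size C)))

  Valid : Cert → Config → Set
  Valids : List Cert → List Config → Set
  Valid (decide k)    C = Decides C (digit k)
  Valid (expand y cs) C = y < size C × deg C y < 3 × Valids cs (children C y)
  Valids []       []       = ⊤
  Valids (c ∷ cs) (C ∷ Cs) = Valid c C × Valids cs Cs
  Valids []       (_ ∷ _)  = ⊥
  Valids (_ ∷ _)  []       = ⊥

  valid? : ∀ c C → Dec (Valid c C)
  valids? : ∀ cs Cs → Dec (Valids cs Cs)
  valid? (decide k)    C = decides? C (digit k)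
  valid? (expand y cs) C = y <? size C ×-dec deg C y <? 3 ×-dec valids? cs (children C y)
  valids? []       []       = yes tt
  valids? (c ∷ cs) (C ∷ Cs) = valid? c C ×-dec valids? cs Cs
  valids? []       (_ ∷ _)  = no λ ()
  valids? (_ ∷ _)  []       = no λ ()

  root : Type → Config
  root t = config 1 (λ _ → t) [] [] (λ _ → types)

Certified : ℕ → List Type → Cert → Type → Set
Certified loss types c t = Certificates.Valid loss types c (Certificates.root loss types t)

certified? : ∀ loss types c t → Dec (Certified loss types c t)
certified? loss types c t = Certificates.valid? loss types c (Certificates.root loss types t)

-- Soundness of certificates

[≔]-same : (f : ℕ → A) (k : ℕ) (a : A) → (f [ k ≔ a ]) k ≡ a
[≔]-same f k a with k ≟ k
... | yes _   = refl
... | no  k≢k = contradiction refl k≢k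

[≔]-other : (f : ℕ → A) {k i : ℕ} (a : A) → i ≢ k → (f [ k ≔ a ]) i ≡ f i
[≔]-other f {k} {i} a i≢k with i ≟ k
... | yes i≡k = contradiction i≡k i≢k
... | no  _   = refl

∈-neighbours⁻ : ∀ es {i j} → j ∈ neighbours es i → (i , j) ∈ es ⊎ (j , i) ∈ es
∈-neighbours⁻ es {i} {j} j∈ with ∈-++⁻ (map proj₂ (filter (λ e → proj₁ e ≟ i) es)) j∈
... | inj₁ p with (_ , _) , q , refl ← ∈-map⁻ proj₂ p with e∈ , refl ← ∈-filter⁻ (λ e → proj₁ e ≟ i) q = inj₁ e∈
... | inj₂ p with (_ , _) , q , refl ← ∈-map⁻ proj₁ p with e∈ , refl ← ∈-filter⁻ (λ e → proj₂ e ≟ i) q = inj₂ e∈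

∈-neighbours⁺ : ∀ es {i j} → (i , j) ∈ es ⊎ (j , i) ∈ es → j ∈ neighbours es i
∈-neighbours⁺ es {i} (inj₁ e∈) = ∈-++⁺ˡ (∈-map⁺ proj₂ (∈-filter⁺ (λ e → proj₁ e ≟ i) e∈ refl))
∈-neighbours⁺ es {i} (inj₂ e∈) = ∈-++⁺ʳ _ (∈-map⁺ proj₁ (∈-filter⁺ (λ e → proj₂ e ≟ i) e∈ refl))

neighbours-∷ : ∀ e es {i j} → j ∈ neighbours es i → j ∈ neighbours (e ∷ es) i
neighbours-∷ e es j∈ with ∈-neighbours⁻ es j∈
... | inj₁ e∈ = ∈-neighbours⁺ (e ∷ es) (inj₁ (there e∈))
... | inj₂ e∈ = ∈-neighbours⁺ (e ∷ es) (inj₂ (there e∈))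

neighbours-sym : ∀ es {i j} → j ∈ neighbours es i → i ∈ neighbours es j
neighbours-sym es j∈ with ∈-neighbours⁻ es j∈
... | inj₁ e∈ = ∈-neighbours⁺ es (inj₂ e∈)
... | inj₂ e∈ = ∈-neighbours⁺ es (inj₁ e∈)

length-filter-tabulate : ∀ {n} (f : A → Bool) (g : Fin n → A) →
  length (filter (λ a → f a Bool.≟ true) (tabulate g)) ≡ ∣ Vec.tabulate (f ∘ g) ∣
length-filter-tabulate {n = zero}  f g = refl
length-filter-tabulate {n = suc n} f g with f (g zero)
... | true  = cong suc (length-filter-tabulate f (g ∘ suc))
... | false = length-filter-tabulate f (g ∘ suc)

length-filter-Status : (st : A → Status) (xs : List A) →
  length (filter (λ x → st x ≟ˢ 𝕊) xs) + length (filter (λ x → st x ≟ˢ 𝕋) xs)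
    + length (filter (λ x → st x ≟ˢ 𝕌) xs) ≡ length xs
length-filter-Status st [] = refl
length-filter-Status st (x ∷ xs) with ih ← length-filter-Status st xs with st x
... | 𝕊 = cong suc ih
... | 𝕋 = trans (cong (_+ length (filter (λ x → st x ≟ˢ 𝕌) xs))
                  (+-suc (length (filter (λ x → st x ≟ˢ 𝕊) xs)) _)) (cong suc ih)
... | 𝕌 = trans (+-suc _ _) (cong suc ih)

indicator : Status → ℕ
indicator 𝕌 = 1
indicator 𝕊 = 0
indicator 𝕋 = 0

indicator≤1 : ∀ σ → indicator σ ≤ 1
indicator≤1 𝕌 = ≤-refl
indicator≤1 𝕊 = z≤n
indicator≤1 𝕋 = z≤n

-- Partial decisions on a cubic graph and their potential

module Peeling {n : ℕ} (G : Graph n) (cubic : Cubic G) where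

  open DecMembership (Fin._≟_ {n}) using (_∈?_)

  N : Fin n → List (Fin n)
  N v = filter (λ w → adj G v w Bool.≟ true) (allFin n)

  ∈N⁺ : ∀ {v w} → Adj G v w → w ∈ N v
  ∈N⁺ = ∈-filter⁺ (λ w → adj G _ w Bool.≟ true) (∈-allFin _)

  ∈N⁻ : ∀ {v w} → w ∈ N v → Adj G v w
  ∈N⁻ = proj₂ ∘ ∈-filter⁻ (λ w → adj G _ w Bool.≟ true) {xs = allFin n}

  Adj-sym : ∀ {v w} → Adj G v w → Adj G w v
  Adj-sym {v} {w} = trans (sym G w v)

  State : Set
  State = Fin n → Status

  marked : State → Status → Fin n → List (Fin n)
  marked st σ v = filter (λ w → st w ≟ˢ σ) (N v)

  marked-unique : ∀ st σ v → Unique (marked st σ v)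
  marked-unique st σ v = Unique.filter⁺ _ (Unique.filter⁺ _ (Unique.allFin⁺ n))

  ∈marked⁺ : ∀ {st σ v w} → Adj G v w → st w ≡ σ → w ∈ marked st σ v
  ∈marked⁺ {st} {σ} a eq = ∈-filter⁺ (λ w → st w ≟ˢ σ) (∈N⁺ a) eq

  ∈marked⁻ : ∀ {st σ v w} → w ∈ marked st σ v → Adj G v w × st w ≡ σ
  ∈marked⁻ {st} {σ} {v} w∈ with w∈N , eq ← ∈-filter⁻ (λ w → st w ≟ˢ σ) {xs = N v} w∈ = ∈N⁻ w∈N , eq

  # : State → Status → Fin n → ℕ
  # st σ v = length (marked st σ v)

  #-total : ∀ st v → # st 𝕊 v + # st 𝕋 v + # st 𝕌 v ≡ 3
  #-total st v = trans (length-filter-Status st (N v)) (trans (length-filter-tabulate (adj G v) id) (cubic v))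

  potential : State → ℕ
  potential st = ∑ λ v → value (st v) (# st 𝕊 v) (# st 𝕋 v)

  undecided : State → ℕ
  undecided st = ∑ (indicator ∘ st)

  Good : State → Set
  Good st = ∀ v → st v ≡ 𝕋 → (∃[ u ] Adj G v u × st u ≡ 𝕊) × (∃[ w ] Adj G v w × st w ≡ 𝕋)

  Step : ℕ → State → Set
  Step loss st = ∃[ st′ ] Good st′ × undecided st′ < undecided st × potential st ≤ loss + potential st′

  -- Such a `v` may well be a named vertex, as long as its edge to `ρ i` has not been recorded.
  Unexplored : State → Config → (ℕ → Fin n) → ℕ → Fin n → Set
  Unexplored st C ρ i v = Adj G (ρ i) v × st v ≡ 𝕌 × v ∉ map ρ (nb C i)

  -- The recorded types are exact, whereas `edges` and `apart` may be incomplete. The lists of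
  -- `available` bound the unknown types from above, which is what an exhaustive branching requires.
  record Represents (st : State) (C : Config) (ρ : ℕ → Fin n) : Set where
    field
      injective : ∀ {i j} → i < size C → j < size C → ρ i ≡ ρ j → i ≡ j
      open-U    : ∀ {i} → i < size C → st (ρ i) ≡ 𝕌
      type-S    : ∀ {i} → i < size C → # st 𝕊 (ρ i) ≡ proj₁ (type C i)
      type-T    : ∀ {i} → i < size C → # st 𝕋 (ρ i) ≡ proj₂ (type C i)
      edge      : ∀ {i j} → (i , j) ∈ edges C → i < size C × j < size C × Adj G (ρ i) (ρ j)
      non-edge  : ∀ {i j} → (i , j) ∈ apart C → i < size C × j < size C × ¬ Adj G (ρ i) (ρ j)
      available : ∀ {i v} → i < size C → Unexplored st C ρ i v → (# st 𝕊 v , # st 𝕋 v) ∈ avail C i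

  module _ {st : State} {C : Config} {ρ : ℕ → Fin n} (rep : Represents st C ρ) where
    open Represents rep

    nb-edge : ∀ {i j} → j ∈ nb C i → j < size C × Adj G (ρ i) (ρ j)
    nb-edge j∈ with ∈-neighbours⁻ (edges C) j∈
    ... | inj₁ e∈ = let _ , j< , a = edge e∈ in j< , a
    ... | inj₂ e∈ = let j< , _ , a = edge e∈ in j< , Adj-sym a

    nb⊆marked : ∀ {i v} → v ∈ map ρ (nb C i) → v ∈ marked st 𝕌 (ρ i)
    nb⊆marked v∈ with j , j∈ , refl ← ∈-map⁻ ρ v∈ = let j< , a = nb-edge j∈ in ∈marked⁺ {st} a (open-U j<)

    nb-unique : ∀ {i} → Unique (nb C i) → Unique (map ρ (nb C i))
    nb-unique = map-unique λ j∈ k∈ → injective (proj₁ (nb-edge j∈)) (proj₁ (nb-edge k∈))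

    type-total : ∀ {i} → i < size C → proj₁ (type C i) + proj₂ (type C i) + # st 𝕌 (ρ i) ≡ 3
    type-total i< = trans (cong₂ (λ s t → s + t + # st 𝕌 _) (≡-sym (type-S i<)) (≡-sym (type-T i<))) (#-total st _)

    not-overfull : ∀ {i} → i < size C → ¬ Overfull C i
    not-overfull {i} i< (deg>3 , uniq) = <⇒≱ deg>3 (subst (deg C i ≤_) (type-total i<)
      (+-monoʳ-≤ (proj₁ (type C i) + proj₂ (type C i))
        (subst (_≤ # st 𝕌 (ρ i)) (length-map ρ (nb C i))
          (unique-⊆⇒length-≤ (nb-unique uniq) nb⊆marked))))

    -- The recorded neighbours are as many as the undecided neighbours of `ρ i`, so they exhaust
    -- them.
    full⇒named : ∀ {i} → i < size C → Unique (nb C i) → deg C i ≡ 3 →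
      ∀ {v} → Adj G (ρ i) v → st v ≡ 𝕌 → ∃[ j ] j ∈ nb C i × v ≡ ρ j
    full⇒named {i} i< uniq full a eq = ∈-map⁻ ρ
      (unique-⊆-short⇒⊇ Fin._≟_ (nb-unique uniq) nb⊆marked
        (≤-reflexive (trans (+-cancelˡ-≡ (proj₁ (type C i) + proj₂ (type C i)) _ _
          (trans (type-total i<) (≡-sym full))) (≡-sym (length-map ρ (nb C i)))))
        (∈marked⁺ {st} a eq))

    -- The decided and the recorded neighbours do not add up to three, so some undecided neighbour
    -- is missing from the record.
    unexplored : ∀ {i} → i < size C → deg C i < 3 → ∃[ w ] Unexplored st C ρ i w
    unexplored {i} i< free
      with w , w∈ , w∉ ← unique-longer⇒∃∉ Fin._≟_ (marked-unique st 𝕌 (ρ i))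
      (subst (_< # st 𝕌 (ρ i)) (≡-sym (length-map ρ (nb C i)))
        (+-cancelˡ-< (proj₁ (type C i) + proj₂ (type C i)) _ _ (subst (deg C i <_) (≡-sym (type-total i<)) free)))
      with a , w-U ← ∈marked⁻ {st} w∈ = w , a , w-U , w∉

    represents-link : ∀ {y z} → y < size C → z < size C → Adj G (ρ y) (ρ z) → Represents st (link C y z) ρ
    represents-link {y} {z} y< z< a = record
      { injective = injective ; open-U = open-U ; type-S = type-S ; type-T = type-T
      ; edge = λ { (here refl) → y< , z< , a ; (there e∈) → edge e∈ }
      ; non-edge = non-edge
      ; available = λ i< (b , v-U , v∉) → available i< (b , v-U , λ v∈ → v∉ (explored v∈)) }
      where
      explored : ∀ {i v} → v ∈ map ρ (nb C i) → v ∈ map ρ (nb (link C y z) i)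
      explored v∈ with j , j∈ , refl ← ∈-map⁻ ρ v∈ = ∈-map⁺ ρ (neighbours-∷ (y , z) (edges C) j∈)

    represents-separate : ∀ {y z} → y < size C → z < size C → ¬ Adj G (ρ y) (ρ z) → Represents st (separate C y z) ρ
    represents-separate y< z< ¬a = record
      { injective = injective ; open-U = open-U ; type-S = type-S ; type-T = type-T ; edge = edge
      ; non-edge = λ { (here refl) → y< , z< , ¬a ; (there e∈) → non-edge e∈ }
      ; available = available }

    module _ {types y w ts} (allowed : ∀ v → st v ≡ 𝕌 → (# st 𝕊 v , # st 𝕋 v) ∈ types)
             (y< : y < size C) (a : Adj G (ρ y) w) (w-U : st w ≡ 𝕌) (fresh : ∀ {i} → i < size C → ρ i ≢ w)
             (remaining : ∀ {v} → Unexplored st C ρ y v → (# st 𝕊 v , # st 𝕋 v) ∈ (# st 𝕊 w , # st 𝕋 w) ∷ ts) where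

      private
        ρ′ = ρ [ size C ≔ w ]
        C′ = Children.grow types C y (# st 𝕊 w , # st 𝕋 w) ts

        old-or-new : ∀ {i} → i < suc (size C) → i < size C ⊎ i ≡ size C
        old-or-new = m<1+n⇒m<n∨m≡n

        ρ′-new : ρ′ (size C) ≡ w
        ρ′-new = [≔]-same ρ (size C) w

        ρ′-old : ∀ {i} → i < size C → ρ′ i ≡ ρ i
        ρ′-old i< = [≔]-other ρ w (<⇒≢ i<)

        type-new : type C′ (size C) ≡ (# st 𝕊 w , # st 𝕋 w)
        type-new = [≔]-same (type C) (size C) _

        type-old : ∀ {i} → i < size C → type C′ i ≡ type C i
        type-old i< = [≔]-other (type C) _ (<⇒≢ i<)

        injective′ : ∀ {i j} → i < suc (size C) → j < suc (size C) → ρ′ i ≡ ρ′ j → i ≡ j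
        injective′ i< j< eq with old-or-new i< | old-or-new j<
        ... | inj₁ i<′  | inj₁ j<′  = injective i<′ j<′ (trans (≡-sym (ρ′-old i<′)) (trans eq (ρ′-old j<′)))
        ... | inj₁ i<′  | inj₂ refl = contradiction (trans (≡-sym (ρ′-old i<′)) (trans eq ρ′-new)) (fresh i<′)
        ... | inj₂ refl | inj₁ j<′  = contradiction (trans (≡-sym (ρ′-old j<′)) (trans (≡-sym eq) ρ′-new)) (fresh j<′)
        ... | inj₂ refl | inj₂ refl = refl

        open-U′ : ∀ {i} → i < suc (size C) → st (ρ′ i) ≡ 𝕌
        open-U′ i< with old-or-new i<
        ... | inj₁ i<′  = trans (cong st (ρ′-old i<′)) (open-U i<′)
        ... | inj₂ refl = trans (cong st ρ′-new) w-U

        type-S′ : ∀ {i} → i < suc (size C) → # st 𝕊 (ρ′ i) ≡ proj₁ (type C′ i)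
        type-S′ i< with old-or-new i<
        ... | inj₁ i<′  = trans (cong (# st 𝕊) (ρ′-old i<′)) (trans (type-S i<′) (cong proj₁ (≡-sym (type-old i<′))))
        ... | inj₂ refl = trans (cong (# st 𝕊) ρ′-new) (cong proj₁ (≡-sym type-new))

        type-T′ : ∀ {i} → i < suc (size C) → # st 𝕋 (ρ′ i) ≡ proj₂ (type C′ i)
        type-T′ i< with old-or-new i<
        ... | inj₁ i<′  = trans (cong (# st 𝕋) (ρ′-old i<′)) (trans (type-T i<′) (cong proj₂ (≡-sym (type-old i<′))))
        ... | inj₂ refl = trans (cong (# st 𝕋) ρ′-new) (cong proj₂ (≡-sym type-new))

        edge′ : ∀ {i j} → (i , j) ∈ edges C′ → i < suc (size C) × j < suc (size C) × Adj G (ρ′ i) (ρ′ j)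
        edge′ (here refl) = m<n⇒m<1+n y< , n<1+n _ , subst₂ (Adj G) (≡-sym (ρ′-old y<)) (≡-sym ρ′-new) a
        edge′ (there e∈) with i< , j< , b ← edge e∈ =
          m<n⇒m<1+n i< , m<n⇒m<1+n j< , subst₂ (Adj G) (≡-sym (ρ′-old i<)) (≡-sym (ρ′-old j<)) b

        non-edge′ : ∀ {i j} → (i , j) ∈ apart C → i < suc (size C) × j < suc (size C) × ¬ Adj G (ρ′ i) (ρ′ j)
        non-edge′ e∈ with i< , j< , ¬b ← non-edge e∈ =
          m<n⇒m<1+n i< , m<n⇒m<1+n j< , ¬b ∘ subst₂ (Adj G) (ρ′-old i<) (ρ′-old j<)

        unexplored-old : ∀ {i v} → i < size C → Unexplored st C′ ρ′ i v → Unexplored st C ρ i v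
        unexplored-old {i} {v} i< (b , v-U , v∉) = subst (λ u → Adj G u v) (ρ′-old i<) b , v-U , λ v∈ →
          let j , j∈ , v≡ρj = ∈-map⁻ ρ v∈ in
          v∉ (subst (_∈ map ρ′ (nb C′ i)) (trans (ρ′-old (proj₁ (nb-edge j∈))) (≡-sym v≡ρj))
            (∈-map⁺ ρ′ (neighbours-∷ (y , size C) (edges C) j∈)))

        available′ : ∀ {i v} → i < suc (size C) → Unexplored st C′ ρ′ i v → (# st 𝕊 v , # st 𝕋 v) ∈ avail C′ i
        available′ {i} {v} i< un with old-or-new i<
        ... | inj₂ refl = subst ((# st 𝕊 v , # st 𝕋 v) ∈_)
          (≡-sym ([≔]-same (avail C [ y ≔ _ ]) (size C) types)) (allowed v (proj₁ (proj₂ un)))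
        ... | inj₁ i<′ = subst ((# st 𝕊 v , # st 𝕋 v) ∈_)
          (≡-sym ([≔]-other (avail C [ y ≔ _ ]) types (<⇒≢ i<′))) (old (i ≟ y))
          where
          old : Dec (i ≡ y) → (# st 𝕊 v , # st 𝕋 v) ∈ (avail C [ y ≔ (# st 𝕊 w , # st 𝕋 w) ∷ ts ]) i
          old (yes refl) = subst ((# st 𝕊 v , # st 𝕋 v) ∈_) (≡-sym ([≔]-same (avail C) y _))
            (remaining (unexplored-old i<′ un))
          old (no  i≢y)  = subst ((# st 𝕊 v , # st 𝕋 v) ∈_) (≡-sym ([≔]-other (avail C) _ i≢y))
            (available i<′ (unexplored-old i<′ un))

      -- Injectivity comes from `fresh`. For `available`, the new vertex uses `allowed`, `y` uses
      -- `remaining`, and the other vertices keep their lists because whatever is unexplored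
      -- afterwards was unexplored before.
      represents-grow : Represents st C′ ρ′
      represents-grow = record
        { injective = injective′ ; open-U = open-U′ ; type-S = type-S′ ; type-T = type-T′
        ; edge = edge′ ; non-edge = non-edge′ ; available = available′ }

  module _ {st : State} {types : List Type} (allowed : ∀ v → st v ≡ 𝕌 → (# st 𝕊 v , # st 𝕋 v) ∈ types)
           {ρ : ℕ → Fin n} {y : ℕ} where
    open Children types

    later-child : ∀ {C Cs} → ∃[ C′ ] C′ ∈ Cs × ∃[ ρ′ ] Represents st C′ ρ′ →
      ∃[ C′ ] C′ ∈ C ∷ Cs × ∃[ ρ′ ] Represents st C′ ρ′
    later-child (C′ , C′∈ , rep) = C′ , there C′∈ , rep

    represented-growth : ∀ {C w} ts → Represents st C ρ → y < size C → Unexplored st C ρ y w →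
      (∀ {v} → Unexplored st C ρ y v → v ∉ map ρ (upTo (size C))) →
      (∀ {v} → Unexplored st C ρ y v → (# st 𝕊 v , # st 𝕋 v) ∈ ts) →
      ∃[ C′ ] C′ ∈ growths C y ts × ∃[ ρ′ ] Represents st C′ ρ′
    represented-growth [] rep y< un unnamed remaining = contradiction (remaining un) λ ()
    represented-growth {C} (t ∷ ts) rep y< un unnamed remaining
      with Fin.any? (λ v → (adj G (ρ y) v Bool.≟ true) ×-dec (st v ≟ˢ 𝕌) ×-dec ¬? (v ∈? map ρ (nb C y))
                           ×-dec ((# st 𝕊 v , # st 𝕋 v) ≟ᵖ t))
    ... | yes (v , a , v-U , v∉ , refl) = _ , here refl , _ ,
      represents-grow rep allowed y< a v-U
        (λ i< ρi≡v → unnamed (a , v-U , v∉) (subst (_∈ map ρ (upTo (size C))) ρi≡v (∈-map⁺ ρ (∈-upTo⁺ i<))))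
        remaining
    ... | no  none = later-child (represented-growth ts rep y< un unnamed λ un′ → later un′ (remaining un′))
      where
      later : ∀ {v} → Unexplored st C ρ y v → (# st 𝕊 v , # st 𝕋 v) ∈ t ∷ ts → (# st 𝕊 v , # st 𝕋 v) ∈ ts
      later (a , v-U , v∉) (here eq) = contradiction (_ , a , v-U , v∉ , eq) none
      later _              (there p) = p

    -- Adjacency to the candidates is decided in turn: the first success selects a `link` branch, a
    -- failure is recorded as a non-edge. The last hypothesis says that the candidates still to be
    -- tried include every named unexplored neighbour.
    represented-offspring : ∀ {C w} zs → Represents st C ρ → y < size C → Unexplored st C ρ y w →
      All (_< size C) zs →
      (∀ {v} → Unexplored st C ρ y v → v ∈ map ρ (upTo (size C)) → v ∈ map ρ zs) →
      ∃[ C′ ] C′ ∈ offspring C y zs × ∃[ ρ′ ] Represents st C′ ρ′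
    represented-offspring {C} [] rep y< un [] named = represented-growth (avail C y) rep y< un
      (λ un′ v∈ → contradiction (named un′ v∈) λ ()) (Represents.available rep y<)
    represented-offspring {C} (z ∷ zs) rep y< un (z< ∷ zs<) named with adj G (ρ y) (ρ z) Bool.≟ true
    ... | yes a  = _ , here refl , ρ , represents-link rep y< z< a
    ... | no  ¬a = later-child (represented-offspring zs (represents-separate rep y< z< ¬a) y< un zs<
                     λ un′ v∈ → later un′ (named un′ v∈))
      where
      later : ∀ {v} → Unexplored st C ρ y v → v ∈ map ρ (z ∷ zs) → v ∈ map ρ zs
      later (a , _) (here refl) = contradiction a ¬a
      later _       (there v∈)  = v∈

    -- Exhaustiveness of the branching. What remains to be seen is that the filter by `linkable?`
    -- never discards a true neighbour.
    represented-child : ∀ {C} → Represents st C ρ → y < size C → deg C y < 3 →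
      ∃[ C′ ] C′ ∈ children C y × ∃[ ρ′ ] Represents st C′ ρ′
    represented-child {C} rep y< few = represented-offspring _ rep y< (proj₂ (unexplored rep y< few))
      (All.tabulate (∈-upTo⁻ ∘ proj₁ ∘ ∈-filter⁻ (linkable? C y))) linkable
      where
      linkable : ∀ {v} → Unexplored st C ρ y v → v ∈ map ρ (upTo (size C)) →
        v ∈ map ρ (filter (linkable? C y) (upTo (size C)))
      linkable (a , v-U , v∉) v∈ with z , z∈ , refl ← ∈-map⁻ ρ v∈ =
        ∈-map⁺ ρ (∈-filter⁺ (linkable? C y) z∈
          ( (λ { refl → contradiction (trans (≡-sym a) (irrefl G (ρ y))) λ () })
          , v∉ ∘ ∈-map⁺ ρ
          , (λ p → proj₂ (proj₂ (Represents.non-edge rep p)) a)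
          , (λ p → proj₂ (proj₂ (Represents.non-edge rep p)) (Adj-sym a))
          -- Overfullness is tested after adding the edge; as the edge is real, the enlarged
          -- configuration is still represented.
          , not-overfull (represents-link rep y< (∈-upTo⁻ z∈) a) (∈-upTo⁻ z∈) ))

  -- The effect of one decision on the graph

  module Decide {st : State} (good : Good st) {C : Config} {ρ : ℕ → Fin n} (rep : Represents st C ρ)
                {loss : ℕ} {types : List Type} (a : ℕ → Status)
                (decides : Certificates.Decides loss types C a) where
    open Represents rep

    names : List (Fin n)
    names = map ρ (upTo (size C))

    name⁺ : ∀ {i} → i < size C → ρ i ∈ names
    name⁺ i< = ∈-map⁺ ρ (∈-upTo⁺ i<)

    name⁻ : ∀ {v} → v ∈ names → ∃[ i ] i < size C × v ≡ ρ i
    name⁻ v∈ with i , i∈ , eq ← ∈-map⁻ ρ v∈ = i , ∈-upTo⁻ i∈ , eq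

    named-or-not : ∀ v → v ∈ names ⊎ v ∉ names
    named-or-not v = toSum (v ∈? names)

    st′ : State
    st′ v with v ∈? names
    ... | yes v∈ = a (proj₁ (name⁻ v∈))
    ... | no  _  = st v

    st′-named : ∀ {i} → i < size C → st′ (ρ i) ≡ a i
    st′-named {i} i< with ρ i ∈? names
    ... | no  ρi∉ = contradiction (name⁺ i<) ρi∉
    ... | yes ρi∈ = cong a (≡-sym (injective i< (proj₁ (proj₂ (name⁻ ρi∈))) (proj₂ (proj₂ (name⁻ ρi∈)))))

    st′-unnamed : ∀ {v} → v ∉ names → st′ v ≡ st v
    st′-unnamed {v} v∉ with v ∈? names
    ... | yes v∈ = contradiction v∈ v∉
    ... | no  _  = refl

    st′-decided : ∀ {v} → st v ≢ 𝕌 → st′ v ≡ st v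
    st′-decided v≢U = st′-unnamed λ v∈ → let i , i< , eq = name⁻ v∈ in
      v≢U (trans (cong st eq) (open-U i<))

    sound : ∀ {i} → i < size C → Sound C a i
    sound i< = All.lookup (proj₁ decides) (∈-upTo⁺ i<)

    -- Locality of a decision: a vertex `x` that changes status is named and newly decided, so by
    -- `Sound` all its undecided neighbours are recorded. Hence `v` is one of these and is named
    -- too.
    changed⇒nb : ∀ {v x} → st v ≡ 𝕌 → Adj G v x → st′ x ≢ st x →
      ∃[ i ] ∃[ j ] i < size C × v ≡ ρ i × j ∈ nb C i × j < size C × x ≡ ρ j
    changed⇒nb {v} {x} v-U adj-vx changed with named-or-not x
    ... | inj₂ x∉ = contradiction (st′-unnamed x∉) changed
    ... | inj₁ x∈
      with j , j< , refl ← name⁻ x∈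
      with uniq , full , _ ← sound j<
      with i , i∈ , v≡ ← full⇒named rep j< uniq
             (full λ a-U → changed (trans (st′-named j<) (trans a-U (≡-sym (open-U j<))))) (Adj-sym adj-vx) v-U
      = i , j , proj₁ (nb-edge rep i∈) , v≡ , neighbours-sym (edges C) i∈ , j< , refl

    #-unnamed : ∀ {v} σ → st v ≡ 𝕌 → v ∉ names → # st′ σ v ≡ # st σ v
    #-unnamed {v} σ v-U v∉ = unique-⇔⇒length-≡ (marked-unique st′ σ v) (marked-unique st σ v)
      (λ x∈ → let adj-vx , eq = ∈marked⁻ {st′} x∈ in ∈marked⁺ {st} adj-vx (trans (≡-sym (unchanged adj-vx)) eq))
      (λ x∈ → let adj-vx , eq = ∈marked⁻ {st} x∈ in ∈marked⁺ {st′} adj-vx (trans (unchanged adj-vx) eq))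
      where
      unchanged : ∀ {x} → Adj G v x → st′ x ≡ st x
      unchanged {x} adj-vx with st′ x ≟ˢ st x
      ... | yes eq      = eq
      ... | no  changed with i , _ , i< , refl , _ ← changed⇒nb v-U adj-vx changed = contradiction (name⁺ i<) v∉

    -- Earlier `σ`-neighbours keep their status, and by `changed⇒nb` the new ones are the recorded
    -- neighbours assigned `σ`. The two lists are disjoint because the latter were undecided.
    #-named : ∀ {i σ} → σ ≢ 𝕌 → i < size C → # st′ σ (ρ i) ≡ # st σ (ρ i) + hits C a σ i
    #-named {i} {σ} σ≢U i< = trans
      (unique-⇔⇒length-≡ (marked-unique st′ σ (ρ i))
        (Unique.++⁺ (marked-unique st σ (ρ i)) hit-unique disjoint) to from)
      (trans (length-++ (marked st σ (ρ i))) (cong (# st σ (ρ i) +_) (length-map ρ hit)))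
      where
      hit : List ℕ
      hit = filter (λ j → a j ≟ˢ σ) (nb C i)
      hit⁻ : ∀ {j} → j ∈ hit → j ∈ nb C i × a j ≡ σ
      hit⁻ = ∈-filter⁻ (λ j → a j ≟ˢ σ) {xs = nb C i}
      hit-unique : Unique (map ρ hit)
      hit-unique = map-unique
        (λ j∈ k∈ → injective (proj₁ (nb-edge rep (proj₁ (hit⁻ j∈)))) (proj₁ (nb-edge rep (proj₁ (hit⁻ k∈)))))
        (Unique.filter⁺ _ (proj₁ (sound i<)))
      disjoint : ∀ {x} → ¬ (x ∈ marked st σ (ρ i) × x ∈ map ρ hit)
      disjoint (x∈ , x∈hit) with j , j∈ , refl ← ∈-map⁻ ρ x∈hit =
        σ≢U (trans (≡-sym (proj₂ (∈marked⁻ {st} x∈))) (open-U (proj₁ (nb-edge rep (proj₁ (hit⁻ j∈))))))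
      to : ∀ {x} → x ∈ marked st′ σ (ρ i) → x ∈ marked st σ (ρ i) ++ map ρ hit
      to {x} x∈ with adj-x , eq ← ∈marked⁻ {st′} x∈ with st′ x ≟ˢ st x
      ... | yes same    = ∈-++⁺ˡ (∈marked⁺ {st} adj-x (trans (≡-sym same) eq))
      ... | no  changed with k , j , k< , ρi≡ρk , j∈ , j< , refl ← changed⇒nb (open-U i<) adj-x changed
                        with refl ← injective i< k< ρi≡ρk =
        ∈-++⁺ʳ _ (∈-map⁺ ρ (∈-filter⁺ (λ j → a j ≟ˢ σ) j∈ (trans (≡-sym (st′-named j<)) eq)))
      from : ∀ {x} → x ∈ marked st σ (ρ i) ++ map ρ hit → x ∈ marked st′ σ (ρ i)
      from x∈ with ∈-++⁻ (marked st σ (ρ i)) x∈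
      ... | inj₁ x∈marked with adj-x , eq ← ∈marked⁻ {st} x∈marked =
        ∈marked⁺ {st′} adj-x (trans (st′-decided λ x-U → σ≢U (trans (≡-sym eq) x-U)) eq)
      ... | inj₂ x∈hit with j , j∈hit , refl ← ∈-map⁻ ρ x∈hit
                       with j∈ , eq ← hit⁻ j∈hit
                       with j< , adj-x ← nb-edge rep j∈ = ∈marked⁺ {st′} adj-x (trans (st′-named j<) eq)

    -- Old witnesses survive because decided vertices never change. A newly decided `𝕋`-vertex finds
    -- its witnesses among the neighbours counted in its type or among recorded neighbours decided
    -- at the same time.
    good′ : Good st′
    good′ v v-T with named-or-not v
    ... | inj₂ v∉ with (u , adj-u , u-S) , (w , adj-w , w-T) ← good v (trans (≡-sym (st′-unnamed v∉)) v-T) =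
      (u , adj-u , trans (st′-decided λ u-U → contradiction (trans (≡-sym u-S) u-U) λ ()) u-S) ,
      (w , adj-w , trans (st′-decided λ w-U → contradiction (trans (≡-sym w-T) w-U) λ ()) w-T)
    ... | inj₁ v∈ with i , i< , refl ← name⁻ v∈
                  with has-S , has-T ← proj₂ (proj₂ (sound i<)) (trans (≡-sym (st′-named i<)) v-T) =
      witness (type-S i<) (λ ()) has-S , witness (type-T i<) (λ ()) has-T
      where
      witness : ∀ {σ k} → # st σ (ρ i) ≡ k → σ ≢ 𝕌 → 0 < k ⊎ Any (λ j → a j ≡ σ) (nb C i) →
        ∃[ u ] Adj G (ρ i) u × st′ u ≡ σ
      witness {σ} count σ≢U (inj₁ 0<k) with marked st σ (ρ i) in eq
      ... | []    = contradiction (subst (0 <_) (≡-sym count) 0<k) λ ()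
      ... | u ∷ _ with adj-u , u-σ ← ∈marked⁻ {st} {σ} {ρ i} {u} (subst (u ∈_) (≡-sym eq) (here refl)) =
        u , adj-u , trans (st′-decided λ u-U → σ≢U (trans (≡-sym u-σ) u-U)) u-σ
      witness count σ≢U (inj₂ any) with j , j∈ , a-σ ← find any with j< , adj-j ← nb-edge rep j∈ =
        ρ j , adj-j , trans (st′-named j<) a-σ

    value-old value-new : Fin n → ℕ
    value-old v = value (st v) (# st 𝕊 v) (# st 𝕋 v)
    value-new v = value (st′ v) (# st′ 𝕊 v) (# st′ 𝕋 v)

    -- The value of a decided vertex ignores its neighbours, and an undecided vertex outside `names`
    -- has no neighbour whose status changes.
    value-unnamed : ∀ v → v ∉ names → value-old v ≡ value-new v
    value-unnamed v v∉ rewrite st′-unnamed v∉ with st v in eq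
    ... | 𝕌 = ≡-sym (cong₂ weight (#-unnamed 𝕊 eq v∉) (#-unnamed 𝕋 eq v∉))
    ... | 𝕊 = refl
    ... | 𝕋 = refl

    value-named-old : ∀ {i} → i < size C → value-old (ρ i) ≡ oldValue C i
    value-named-old i< rewrite open-U i< = cong₂ weight (type-S i<) (type-T i<)

    value-named-new : ∀ {i} → i < size C → value-new (ρ i) ≡ newValue C a i
    value-named-new {i} i< = trans (cong (λ σ → value σ (# st′ 𝕊 (ρ i)) (# st′ 𝕋 (ρ i))) (st′-named i<))
      (cong₂ (value (a i))
        (trans (#-named (λ ()) i<) (cong (_+ hits C a 𝕊 i) (type-S i<)))
        (trans (#-named (λ ()) i<) (cong (_+ hits C a 𝕋 i) (type-T i<))))

    sum-names : ∀ {f : Fin n → ℕ} {g} → (∀ {i} → i < size C → f (ρ i) ≡ g i) →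
      sum (map f names) ≡ sum (map g (upTo (size C)))
    sum-names eq = cong sum (trans (≡-sym (map-∘ (upTo (size C)))) (map-cong-local (All.tabulate (eq ∘ ∈-upTo⁻))))

    -- By `∑-exchange` the comparison reduces to the named vertices, where it is the inequality
    -- checked in `Decides`.
    potential-≤ : potential st ≤ loss + potential st′
    potential-≤ = +-cancelʳ-≤ new _ _ (begin
      potential st + new
        ≡⟨ cong (potential st +_) (sum-names value-named-new) ⟨
      potential st + sum (map value-new names)
        ≡⟨ ∑-exchange (map-unique (λ i∈ j∈ → injective (∈-upTo⁻ i∈) (∈-upTo⁻ j∈)) (Unique.upTo⁺ (size C)))
                      value-unnamed ⟩
      potential st′ + sum (map value-old names)
        ≡⟨ cong (potential st′ +_) (sum-names value-named-old) ⟩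
      potential st′ + sum (map (oldValue C) (upTo (size C)))
        ≤⟨ +-monoʳ-≤ (potential st′) (proj₂ (proj₂ decides)) ⟩
      potential st′ + (loss + new)
        ≡⟨ +-assoc (potential st′) loss new ⟨
      (potential st′ + loss) + new
        ≡⟨ cong (_+ new) (+-comm (potential st′) loss) ⟩
      (loss + potential st′) + new ∎)
      where
      open ≤-Reasoning
      new = sum (map (newValue C a) (upTo (size C)))

    undecided-< : undecided st′ < undecided st
    undecided-< with i , i∈ , a≢U ← find (proj₁ (proj₂ decides)) = ∑-mono-< weaker (ρ i) strict
      where
      i< = ∈-upTo⁻ i∈
      weaker : ∀ v → indicator (st′ v) ≤ indicator (st v)
      weaker v with st v in eq
      ... | 𝕌 = indicator≤1 (st′ v)
      ... | 𝕊 rewrite st′-decided {v} (λ v-U → contradiction (trans (≡-sym eq) v-U) λ ()) | eq = ≤-refl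
      ... | 𝕋 rewrite st′-decided {v} (λ v-U → contradiction (trans (≡-sym eq) v-U) λ ()) | eq = ≤-refl
      strict : indicator (st′ (ρ i)) < indicator (st (ρ i))
      strict rewrite open-U i< | st′-named i< with a i
      ... | 𝕌 = contradiction refl a≢U
      ... | 𝕊 = s≤s z≤n
      ... | 𝕋 = s≤s z≤n

    step : Step loss st
    step = st′ , good′ , undecided-< , potential-≤

  -- From certificates to steps

  module _ {st : State} (good : Good st) {loss : ℕ} {types : List Type}
           (allowed : ∀ v → st v ≡ 𝕌 → (# st 𝕊 v , # st 𝕋 v) ∈ types) where
    open Certificates loss types

    -- A walk down the tree: at `expand` the graph determines a represented child, at a leaf the
    -- decision is carried out.
    valid⇒step : ∀ c {C ρ} → Valid c C → Represents st C ρ → Step loss st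
    valids⇒step : ∀ cs {Cs C ρ} → Valids cs Cs → C ∈ Cs → Represents st C ρ → Step loss st
    valid⇒step (decide k) decides rep = Decide.step good rep {types = types} (digit k) decides
    valid⇒step (expand y cs) (y< , free , valids) rep
      with _ , C′∈ , _ , rep′ ← represented-child allowed rep y< free = valids⇒step cs valids C′∈ rep′
    valids⇒step (c ∷ cs) {_ ∷ _} (valid , _)  (here refl) rep = valid⇒step c valid rep
    valids⇒step (c ∷ cs) {_ ∷ _} (_ , valids) (there C∈)  rep = valids⇒step cs valids C∈ rep

    root⇒step : ∀ {c v} → Valid c (root (# st 𝕊 v , # st 𝕋 v)) → st v ≡ 𝕌 → Step loss st
    root⇒step {c} {v} valid v-U = valid⇒step c {ρ = λ _ → v} valid record
      { injective = λ { (s≤s z≤n) (s≤s z≤n) _ → refl } ; open-U = λ _ → v-U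
      ; type-S = λ _ → refl ; type-T = λ _ → refl ; edge = λ () ; non-edge = λ ()
      ; available = λ _ (_ , w-U , _) → allowed _ w-U }

-- The types are in order of priority: the certificate of a type may assume that no undecided vertex
-- has an earlier type.
Phases : List (Type × Cert) → Set
Phases []             = ⊤
Phases ((τ , c) ∷ ps) = Certified 0 (τ ∷ map proj₁ ps ++ (0 , 0) ∷ []) c τ × Phases ps

phases? : ∀ ps → Dec (Phases ps)
phases? []             = yes tt
phases? ((τ , c) ∷ ps) = certified? 0 (τ ∷ map proj₁ ps ++ (0 , 0) ∷ []) c τ ×-dec phases? ps

∣tabulate∣ : ∀ {n} (f : Fin n → Bool) (g : Fin n → ℕ) →
  (∀ v → f v ≡ true → g v ≡ 1) → (∀ v → f v ≡ false → g v ≡ 0) → ∣ Vec.tabulate f ∣ ≡ ∑ g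
∣tabulate∣ {zero}  f g one nil = refl
∣tabulate∣ {suc n} f g one nil with f zero in eq
... | true  = cong₂ _+_ (≡-sym (one zero eq)) (∣tabulate∣ (f ∘ suc) (g ∘ suc) (one ∘ suc) (nil ∘ suc))
... | false = cong₂ _+_ (≡-sym (nil zero eq)) (∣tabulate∣ (f ∘ suc) (g ∘ suc) (one ∘ suc) (nil ∘ suc))

-- If `b < a`, the left side would exceed `suc k * b` by at least `suc k`, more than the slack `k`.
rounding : ∀ k {a b} → suc k * a ≤ k + suc k * b → a ≤ b
rounding k {a} {b} le with a ≤? b
... | yes a≤b = a≤b
... | no  a≰b = contradiction (≤-trans (*-monoʳ-≤ (suc k) (≰⇒> a≰b)) le)
  (<⇒≱ (subst (k + suc k * b <_) (≡-sym (*-suc (suc k) b)) (n<1+n (k + suc k * b))))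

-- Here `p` is the final potential and `d` the size of the dominating set:
-- `80 * d ≤ (80 - 48) * n = 32 * n`, and 16 cancels.
two-fifths : ∀ {n p d} → 48 * n ≤ p → p + 80 * d ≡ 80 * n → 5 * d ≤ 2 * n
two-fifths {n} {p} {d} le eq = *-cancelˡ-≤ {5 * d} {2 * n} 16
  (subst₂ _≤_ (*-assoc 16 5 d) (*-assoc 16 2 n) 80d≤32n)
  where
  80d≤32n : 80 * d ≤ 32 * n
  80d≤32n = +-cancelˡ-≤ (48 * n) (80 * d) (32 * n)
    (≤-trans (+-monoˡ-≤ (80 * d) le) (≤-reflexive (trans eq (*-distribʳ-+ n 48 32))))

-- The greedy procedure

module Search {n : ℕ} (G : Graph n) (cubic : Cubic G)
              (ps : List (Type × Cert)) (phases : Phases ps)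
              (c₀ : Cert) (valid₀ : Certified 15 ((0 , 0) ∷ []) c₀ (0 , 0))
              (complete : ∀ {s} → s < 4 → ∀ {t} → t < 4 → s + t ≤ 3 → (s , t) ∈ map proj₁ ps ++ (0 , 0) ∷ []) where
  open Peeling G cubic

  Untouched : State → Set
  Untouched st = ∀ v → st v ≡ 𝕌 → (# st 𝕊 v , # st 𝕋 v) ≡ (0 , 0)

  -- Descent along the priority list: if no undecided vertex has the leading type, this type leaves
  -- the allowed list, which is what the next certificate presupposes. At the end only `(0 , 0)` is
  -- left.
  step-or-untouched : ∀ {st} → Good st → ∀ ps → Phases ps →
    (∀ v → st v ≡ 𝕌 → (# st 𝕊 v , # st 𝕋 v) ∈ map proj₁ ps ++ (0 , 0) ∷ []) → Step 0 st ⊎ Untouched st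
  step-or-untouched good [] _ allowed = inj₂ λ v v-U → case-here (allowed v v-U)
    where
    case-here : ∀ {τ} → τ ∈ (0 , 0) ∷ [] → τ ≡ (0 , 0)
    case-here (here eq) = eq
  step-or-untouched {st} good ((τ , c) ∷ ps) (valid , phases) allowed
    with Fin.any? (λ v → (st v ≟ˢ 𝕌) ×-dec ((# st 𝕊 v , # st 𝕋 v) ≟ᵖ τ))
  ... | yes (v , v-U , refl) = inj₁ (root⇒step good allowed {c} valid v-U)
  ... | no  none = step-or-untouched good ps phases λ v v-U → rest v-U (allowed v v-U)
    where
    rest : ∀ {v} → st v ≡ 𝕌 → (# st 𝕊 v , # st 𝕋 v) ∈ τ ∷ map proj₁ ps ++ (0 , 0) ∷ [] →
      (# st 𝕊 v , # st 𝕋 v) ∈ map proj₁ ps ++ (0 , 0) ∷ []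
    rest v-U (here eq)  = contradiction (_ , v-U , eq) none
    rest v-U (there p) = p

  all-types : ∀ st v → (# st 𝕊 v , # st 𝕋 v) ∈ map proj₁ ps ++ (0 , 0) ∷ []
  all-types st v = complete (s≤s (≤-trans (m≤m+n _ _) s+t≤3)) (s≤s (≤-trans (m≤n+m _ _) s+t≤3)) s+t≤3
    where
    s+t≤3 : # st 𝕊 v + # st 𝕋 v ≤ 3
    s+t≤3 = subst (# st 𝕊 v + # st 𝕋 v ≤_) (#-total st v) (m≤m+n _ _)

  -- Only the values 48, 0 and 80 occur, all of them multiples of 16.
  potential-untouched : ∀ {st} → Untouched st → ∃[ q ] potential st ≡ 16 * q
  potential-untouched {st} untouched = ∑ (sixteenth ∘ st) , trans (∑-cong pointwise) (∑-* 16 (sixteenth ∘ st))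
    where
    sixteenth : Status → ℕ
    sixteenth 𝕌 = 3
    sixteenth 𝕊 = 0
    sixteenth 𝕋 = 5
    pointwise : ∀ v → value (st v) (# st 𝕊 v) (# st 𝕋 v) ≡ 16 * sixteenth (st v)
    pointwise v with st v in eq
    ... | 𝕌 = cong (λ τ → weight (proj₁ τ) (proj₂ τ)) (untouched v eq)
    ... | 𝕊 = refl
    ... | 𝕋 = refl

  -- Both `48 * n` and the potential are multiples of 16, so a deficit of at most 15 is none at all.
  untouched-≤ : ∀ {st} → Untouched st → 48 * n ≤ 15 + potential st → 48 * n ≤ potential st
  untouched-≤ {st} untouched le with q , eq ← potential-untouched {st} untouched =
    subst₂ _≤_ (≡-sym (*-assoc 16 3 n)) (≡-sym eq)
      (*-monoʳ-≤ 16 (rounding 15 {3 * n} {q} (subst₂ _≤_ (*-assoc 16 3 n) (cong (15 +_) eq) le)))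

  Finished : Set
  Finished = ∃[ st ] Good st × (∀ v → st v ≢ 𝕌) × 48 * n ≤ potential st

  -- A step without loss preserves the slack of 15. A step that may lose 15 is taken only in an
  -- untouched state, where `untouched-≤` first recovers the exact bound, so losses do not
  -- accumulate.
  finish : ∀ st → Acc _<_ (undecided st) → Good st → 48 * n ≤ 15 + potential st → Finished
  finish st (acc rec) good le with step-or-untouched {st} good ps phases (λ v _ → all-types st v)
  ... | inj₁ (st′ , good′ , fewer , mono) = finish st′ (rec fewer) good′ (≤-trans le (+-monoʳ-≤ 15 mono))
  ... | inj₂ untouched with Fin.any? (λ v → st v ≟ˢ 𝕌)
  ...   | no  none = st , good , (λ v v-U → none (v , v-U)) , untouched-≤ untouched le
  ...   | yes (v , v-U)
    with st′ , good′ , fewer , mono ← root⇒step good {15} (λ u u-U → here (untouched u u-U)) {c₀} {v}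
           (subst (Certified 15 ((0 , 0) ∷ []) c₀) (≡-sym (untouched v v-U)) valid₀) v-U
    = finish st′ (rec fewer) good′ (≤-trans (untouched-≤ untouched le) mono)

  finished : Finished
  -- With nothing decided, `Good` is vacuous and the potential is exactly `48 * n`, which leaves 15
  -- to spare.
  finished = finish (λ _ → 𝕌) (<-wellFounded _) (λ _ ()) (≤-trans (≤-reflexive initial) (m≤n+m _ 15))
    where
    none : ∀ σ v → σ ≢ 𝕌 → # (λ _ → 𝕌) σ v ≡ 0
    none σ v σ≢U = cong length (filter-none (λ _ → 𝕌 ≟ˢ σ) (All.tabulate {xs = N v} λ _ U≡σ → σ≢U (≡-sym U≡σ)))
    initial : 48 * n ≡ potential (λ _ → 𝕌)
    initial = trans (*-comm 48 n) (trans (≡-sym (∑-const n 48))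
      (∑-cong λ v → ≡-sym (cong₂ weight (none 𝕊 v λ ()) (none 𝕋 v λ ()))))

  isS : Status → ℕ
  isS 𝕌 = 0
  isS 𝕊 = 1
  isS 𝕋 = 0

  -- Each vertex contributes 80 in all: through the potential if it is `𝕋`, through the second sum
  -- if it is `𝕊`.
  potential-decided : ∀ st → (∀ v → st v ≢ 𝕌) → potential st + 80 * ∑ (isS ∘ st) ≡ 80 * n
  potential-decided st decided = begin
    potential st + 80 * ∑ (isS ∘ st)         ≡⟨ cong (potential st +_) (∑-* 80 (isS ∘ st)) ⟨
    potential st + ∑ (λ v → 80 * isS (st v)) ≡⟨ ∑-+ (λ v → value (st v) (# st 𝕊 v) (# st 𝕋 v)) (λ v → 80 * isS (st v)) ⟨
    ∑ (λ v → value (st v) (# st 𝕊 v) (# st 𝕋 v) + 80 * isS (st v)) ≡⟨ ∑-cong pointwise ⟩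
    ∑ {n} (λ _ → 80)                         ≡⟨ ∑-const n 80 ⟩
    n * 80                                   ≡⟨ *-comm n 80 ⟩
    80 * n                                   ∎
    where
    open ≡-Reasoning
    pointwise : ∀ v → value (st v) (# st 𝕊 v) (# st 𝕋 v) + 80 * isS (st v) ≡ 80
    pointwise v with st v in eq
    ... | 𝕌 = contradiction eq (decided v)
    ... | 𝕊 = refl
    ... | 𝕋 = refl

  finished⇒bound : Finished → ∃[ D ] (IsRestrainedDominating G D × 5 * ∣ D ∣ ≤ 2 * n)
  finished⇒bound (st , good , decided , le) = D , dominating ,
    two-fifths {n} {potential st} {∣ D ∣} le (trans (cong (λ k → potential st + 80 * k)
      (∣tabulate∣ _ (isS ∘ st) one nil)) (potential-decided st decided))
    where
    D : Subset n
    D = Vec.tabulate λ v → does (st v ≟ˢ 𝕊)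
    ∈D : ∀ {v} → st v ≡ 𝕊 → v Subset.∈ D
    ∈D {v} v-S = Vec.lookup⇒[]= v D (trans (Vec.lookup∘tabulate _ v) (dec-true (st v ≟ˢ 𝕊) v-S))
    ∉D⇒T : ∀ {v} → v Subset.∉ D → st v ≡ 𝕋
    ∉D⇒T {v} v∉ with st v in eq
    ... | 𝕌 = contradiction eq (decided v)
    ... | 𝕊 = contradiction (∈D eq) v∉
    ... | 𝕋 = refl
    T⇒∉D : ∀ {v} → st v ≡ 𝕋 → v Subset.∉ D
    T⇒∉D {v} v-T v∈ with trans (≡-sym (Vec.lookup∘tabulate _ v)) (Vec.[]=⇒lookup v∈)
    ... | eq rewrite v-T = contradiction eq λ ()
    dominating : IsRestrainedDominating G D
    dominating v v∉ with (u , adj-u , u-S) , (w , adj-w , w-T) ← good v (∉D⇒T v∉) =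
      (u , adj-u , ∈D u-S) , (w , adj-w , T⇒∉D w-T)
    one : ∀ v → does (st v ≟ˢ 𝕊) ≡ true → isS (st v) ≡ 1
    one v eq with st v
    one v eq | 𝕊 = refl
    nil : ∀ v → does (st v ≟ˢ 𝕊) ≡ false → isS (st v) ≡ 0
    nil v eq with st v
    nil v eq | 𝕌 = refl
    nil v eq | 𝕋 = refl

-- The case trees

-- The six branches are the types still allowed for the only undecided neighbour. As the root has
-- both kinds of neighbour, it may go outside `D` (`decide 2`); next to a vertex of type `(0 , 2)`
-- it joins `D` instead, which turns that type into `(1 , 2)`.
cert₁₁ : Cert
cert₁₁ =
  expand 0 (decide 2 ∷ decide 1 ∷ decide 2 ∷ decide 2 ∷ decide 2 ∷ decide 2 ∷ [])

-- A sample leaf is `decide 5`, with ternary digits 2 and 1: the root goes outside `D`, and its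
-- neighbour of type `(2 , 0)` joins `D` to dominate it.
cert₀₂ : Cert
cert₀₂ =
  expand 0 (decide 1 ∷ decide 5 ∷ decide 1 ∷ expand 1 (decide 3 ∷ decide 24 ∷ decide 3 ∷ expand 2
    (decide 12 ∷ decide 24 ∷ decide 24 ∷ decide 24 ∷ decide 24 ∷ []) ∷ decide 3 ∷ []) ∷ expand 1
    (expand 1 (decide 3 ∷ decide 3 ∷ decide 3 ∷ decide 3 ∷ decide 3 ∷ []) ∷ expand 1 (decide 25 ∷
    decide 25 ∷ decide 25 ∷ decide 25 ∷ []) ∷ expand 1 (decide 3 ∷ decide 3 ∷ decide 3 ∷ []) ∷
    expand 1 (expand 2 (decide 72 ∷ decide 9 ∷ decide 180 ∷ decide 25 ∷ decide 25 ∷ decide 25 ∷ [])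
    ∷ decide 3 ∷ []) ∷ expand 1 (decide 3 ∷ []) ∷ []) ∷ [])

cert₂₀ : Cert
cert₂₀ =
  expand 0 (decide 8 ∷ expand 1 (decide 7 ∷ expand 2 (decide 15 ∷ decide 9 ∷ decide 15 ∷ decide 15 ∷
    []) ∷ decide 7 ∷ expand 2 (expand 2 (decide 75 ∷ decide 15 ∷ expand 4 (decide 648 ∷ decide 153 ∷
    decide 183 ∷ decide 153 ∷ []) ∷ decide 15 ∷ []) ∷ expand 2 (decide 9 ∷ decide 15 ∷ decide 9 ∷
    []) ∷ expand 2 (decide 15 ∷ decide 15 ∷ []) ∷ expand 2 (decide 15 ∷ []) ∷ []) ∷ []) ∷ expand 1
    (decide 8 ∷ decide 8 ∷ decide 8 ∷ decide 8 ∷ []) ∷ expand 1 (expand 1 (decide 25 ∷ decide 25 ∷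
    decide 25 ∷ decide 25 ∷ []) ∷ expand 1 (expand 2 (decide 63 ∷ decide 21 ∷ decide 17 ∷ expand 3
    (decide 75 ∷ decide 57 ∷ decide 35 ∷ expand 4 (decide 648 ∷ decide 1620 ∷ decide 116 ∷ decide
    237 ∷ decide 116 ∷ []) ∷ decide 35 ∷ []) ∷ decide 17 ∷ []) ∷ expand 2 (decide 17 ∷ expand 3
    (decide 540 ∷ decide 35 ∷ decide 69 ∷ decide 35 ∷ []) ∷ decide 17 ∷ decide 17 ∷ decide 17 ∷ [])
    ∷ expand 2 (decide 17 ∷ decide 21 ∷ decide 17 ∷ decide 17 ∷ decide 17 ∷ []) ∷ []) ∷ expand 1
    (expand 2 (decide 72 ∷ decide 180 ∷ decide 17 ∷ decide 17 ∷ decide 17 ∷ []) ∷ expand 2 (decide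
    17 ∷ decide 180 ∷ decide 17 ∷ decide 25 ∷ decide 17 ∷ []) ∷ []) ∷ expand 1 (expand 2 (expand 2
    (expand 3 (decide 51 ∷ decide 35 ∷ decide 35 ∷ decide 35 ∷ []) ∷ decide 17 ∷ decide 17 ∷ decide
    17 ∷ []) ∷ expand 2 (decide 183 ∷ expand 5 (decide 423 ∷ decide 495 ∷ decide 423 ∷ decide 423 ∷
    decide 423 ∷ []) ∷ expand 5 (decide 423 ∷ decide 1944 ∷ decide 423 ∷ decide 507 ∷ decide 423 ∷
    []) ∷ expand 3 (expand 3 (decide 1695 ∷ decide 35 ∷ decide 35 ∷ decide 35 ∷ []) ∷ expand 3
    (decide 1515 ∷ decide 1695 ∷ decide 1695 ∷ decide 1695 ∷ []) ∷ expand 3 (decide 27 ∷ decide 35 ∷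
    decide 35 ∷ []) ∷ expand 3 (expand 6 (decide 1695 ∷ decide 5832 ∷ decide 14580 ∷ decide 1695 ∷
    decide 1695 ∷ decide 1695 ∷ []) ∷ decide 35 ∷ []) ∷ expand 3 (decide 35 ∷ []) ∷ []) ∷ []) ∷
    expand 2 (decide 9 ∷ decide 17 ∷ decide 17 ∷ []) ∷ expand 2 (expand 3 (expand 3 (decide 621 ∷
    decide 219 ∷ decide 35 ∷ decide 237 ∷ decide 35 ∷ []) ∷ expand 3 (decide 543 ∷ decide 35 ∷
    decide 561 ∷ decide 35 ∷ []) ∷ expand 3 (decide 1515 ∷ expand 4 (decide 648 ∷ decide 132 ∷
    decide 13284 ∷ decide 132 ∷ decide 1695 ∷ decide 1695 ∷ []) ∷ expand 4 (decide 648 ∷ decide 4536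
    ∷ decide 13284 ∷ decide 1695 ∷ decide 1695 ∷ decide 1695 ∷ []) ∷ expand 4 (decide 648 ∷ decide
    1695 ∷ decide 13284 ∷ decide 1695 ∷ decide 1695 ∷ decide 1695 ∷ []) ∷ []) ∷ expand 3 (decide 27
    ∷ decide 35 ∷ decide 35 ∷ []) ∷ expand 3 (expand 4 (decide 648 ∷ decide 1620 ∷ decide 4536 ∷
    decide 13284 ∷ expand 8 (decide 423 ∷ decide 14013 ∷ decide 15471 ∷ decide 13203 ∷ expand 9
    (decide 46413 ∷ decide 47385 ∷ decide 50301 ∷ decide 45927 ∷ decide 19683 ∷ decide 32967 ∷
    decide 32805 ∷ []) ∷ decide 13228 ∷ decide 13254 ∷ []) ∷ expand 5 (decide 1944 ∷ decide 4860 ∷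
    decide 13608 ∷ decide 39852 ∷ decide 423 ∷ decide 669 ∷ decide 423 ∷ []) ∷ expand 5 (decide 1944
    ∷ decide 4860 ∷ decide 423 ∷ decide 39852 ∷ decide 423 ∷ decide 585 ∷ expand 6 (decide 5832 ∷
    decide 2019 ∷ decide 1695 ∷ decide 119556 ∷ decide 2181 ∷ decide 1695 ∷ decide 1695 ∷ []) ∷ [])
    ∷ []) ∷ decide 35 ∷ []) ∷ expand 3 (decide 35 ∷ []) ∷ []) ∷ decide 17 ∷ []) ∷ expand 2 (decide
    17 ∷ []) ∷ []) ∷ []) ∷ []) ∷ [])

cert₀₁ : Cert
cert₀₁ =
  expand 0 (expand 0 (decide 1 ∷ expand 1 (decide 5 ∷ decide 3 ∷ expand 2 (decide 72 ∷ expand 3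
    (decide 189 ∷ decide 38 ∷ decide 61 ∷ decide 61 ∷ []) ∷ decide 23 ∷ decide 23 ∷ []) ∷ decide 5 ∷
    []) ∷ expand 1 (decide 5 ∷ decide 3 ∷ decide 7 ∷ decide 5 ∷ []) ∷ []) ∷ expand 0 (expand 1
    (decide 5 ∷ decide 5 ∷ expand 3 (decide 72 ∷ decide 60 ∷ decide 60 ∷ decide 60 ∷ []) ∷ expand 2
    (decide 17 ∷ decide 11 ∷ decide 23 ∷ decide 17 ∷ []) ∷ []) ∷ expand 2 (expand 2 (decide 11 ∷
    decide 11 ∷ decide 11 ∷ []) ∷ expand 2 (decide 9 ∷ decide 11 ∷ decide 9 ∷ []) ∷ expand 2 (expand
    3 (decide 60 ∷ decide 216 ∷ expand 1 (decide 168 ∷ decide 489 ∷ decide 50 ∷ expand 6 (decide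
    1620 ∷ decide 1971 ∷ decide 1464 ∷ decide 1464 ∷ decide 1464 ∷ []) ∷ expand 5 (decide 153 ∷
    decide 536 ∷ expand 7 (decide 4779 ∷ decide 2673 ∷ decide 2187 ∷ decide 2727 ∷ decide 2673 ∷ [])
    ∷ decide 536 ∷ decide 536 ∷ []) ∷ []) ∷ decide 73 ∷ expand 1 (decide 168 ∷ expand 4 (decide 621
    ∷ decide 156 ∷ decide 181 ∷ decide 156 ∷ []) ∷ expand 4 (decide 156 ∷ decide 1623 ∷ decide 104 ∷
    decide 181 ∷ decide 156 ∷ []) ∷ expand 6 (decide 1620 ∷ decide 1464 ∷ decide 1464 ∷ decide 1464
    ∷ decide 1464 ∷ []) ∷ expand 4 (decide 156 ∷ decide 235 ∷ decide 156 ∷ decide 181 ∷ decide 235 ∷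
    []) ∷ []) ∷ []) ∷ expand 1 (decide 60 ∷ decide 17 ∷ expand 5 (decide 543 ∷ decide 491 ∷ expand 6
    (decide 1755 ∷ decide 1215 ∷ decide 729 ∷ decide 1712 ∷ decide 1215 ∷ []) ∷ decide 489 ∷ decide
    491 ∷ []) ∷ decide 17 ∷ decide 17 ∷ []) ∷ []) ∷ expand 2 (decide 11 ∷ []) ∷ []) ∷ []) ∷ expand 0
    (expand 1 (expand 1 (decide 3 ∷ expand 2 (decide 17 ∷ decide 9 ∷ decide 17 ∷ decide 11 ∷ []) ∷
    decide 5 ∷ []) ∷ expand 1 (decide 3 ∷ expand 3 (expand 2 (decide 181 ∷ decide 9 ∷ expand 4
    (decide 648 ∷ decide 98 ∷ decide 169 ∷ decide 98 ∷ []) ∷ decide 9 ∷ []) ∷ decide 57 ∷ expand 5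
    (decide 297 ∷ decide 195 ∷ decide 243 ∷ decide 513 ∷ decide 297 ∷ []) ∷ decide 57 ∷ decide 59 ∷
    []) ∷ decide 3 ∷ []) ∷ expand 1 (expand 3 (decide 61 ∷ decide 216 ∷ decide 61 ∷ decide 61 ∷
    decide 61 ∷ []) ∷ expand 3 (decide 61 ∷ expand 4 (decide 219 ∷ decide 141 ∷ decide 219 ∷ decide
    219 ∷ []) ∷ expand 2 (expand 2 (decide 9 ∷ decide 9 ∷ expand 6 (decide 1629 ∷ decide 1971 ∷
    decide 1537 ∷ decide 1477 ∷ decide 1477 ∷ []) ∷ decide 11 ∷ []) ∷ expand 2 (decide 9 ∷ decide
    495 ∷ decide 9 ∷ []) ∷ expand 2 (decide 9 ∷ expand 6 (decide 1469 ∷ decide 1215 ∷ decide 1467 ∷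
    decide 752 ∷ decide 1467 ∷ decide 1469 ∷ []) ∷ decide 9 ∷ []) ∷ expand 2 (expand 6 (decide 1477
    ∷ decide 1971 ∷ decide 5832 ∷ decide 1477 ∷ decide 1477 ∷ decide 1477 ∷ []) ∷ expand 6 (decide
    1477 ∷ decide 1971 ∷ decide 1537 ∷ decide 1537 ∷ decide 1477 ∷ decide 1477 ∷ []) ∷ []) ∷ expand
    2 (decide 11 ∷ []) ∷ []) ∷ decide 61 ∷ decide 61 ∷ []) ∷ []) ∷ expand 1 (decide 5 ∷ []) ∷ []) ∷
    []) ∷ [])

cert₁₀ : Cert
cert₁₀ =
  expand 0 (expand 0 (expand 1 (decide 8 ∷ decide 8 ∷ decide 8 ∷ []) ∷ expand 1 (decide 8 ∷ decide 8
    ∷ decide 8 ∷ []) ∷ []) ∷ expand 0 (expand 1 (expand 1 (expand 2 (decide 17 ∷ decide 25 ∷ decide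
    17 ∷ []) ∷ expand 2 (decide 17 ∷ decide 25 ∷ decide 17 ∷ []) ∷ []) ∷ expand 1 (expand 3 (decide
    35 ∷ decide 216 ∷ decide 61 ∷ decide 35 ∷ []) ∷ expand 3 (decide 35 ∷ decide 35 ∷ decide 61 ∷
    expand 2 (expand 2 (expand 4 (decide 89 ∷ decide 89 ∷ decide 89 ∷ []) ∷ expand 4 (decide 89 ∷
    decide 89 ∷ decide 89 ∷ decide 89 ∷ []) ∷ expand 4 (decide 89 ∷ decide 89 ∷ decide 89 ∷ decide
    89 ∷ []) ∷ []) ∷ expand 2 (expand 4 (expand 4 (decide 141 ∷ decide 141 ∷ decide 89 ∷ []) ∷
    expand 4 (decide 944 ∷ decide 143 ∷ []) ∷ expand 4 (expand 6 (decide 263 ∷ decide 5832 ∷ decide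
    14580 ∷ decide 1477 ∷ decide 1537 ∷ []) ∷ decide 143 ∷ []) ∷ expand 4 (decide 89 ∷ []) ∷ []) ∷
    expand 6 (expand 6 (decide 1233 ∷ expand 4 (decide 89 ∷ decide 5913 ∷ decide 143 ∷ decide 89 ∷
    []) ∷ decide 749 ∷ []) ∷ expand 6 (decide 1233 ∷ decide 749 ∷ []) ∷ expand 6 (expand 4 (expand 4
    (decide 141 ∷ decide 141 ∷ decide 141 ∷ decide 89 ∷ []) ∷ expand 4 (decide 15471 ∷ decide 5930 ∷
    decide 143 ∷ []) ∷ expand 4 (decide 14678 ∷ decide 143 ∷ []) ∷ expand 4 (expand 7 (decide 4869 ∷
    decide 17496 ∷ decide 43740 ∷ decide 122472 ∷ decide 5841 ∷ decide 5902 ∷ []) ∷ decide 143 ∷ [])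
    ∷ expand 4 (decide 89 ∷ []) ∷ []) ∷ expand 5 (expand 4 (decide 141 ∷ decide 89 ∷ decide 141 ∷
    decide 89 ∷ []) ∷ decide 4869 ∷ decide 1268 ∷ decide 1268 ∷ expand 7 (decide 6381 ∷ decide 6381
    ∷ decide 6381 ∷ decide 6381 ∷ decide 6381 ∷ []) ∷ []) ∷ []) ∷ expand 6 (decide 749 ∷ []) ∷ []) ∷
    []) ∷ expand 2 (expand 6 (decide 749 ∷ decide 749 ∷ decide 5832 ∷ decide 1477 ∷ decide 749 ∷ [])
    ∷ expand 6 (decide 1537 ∷ decide 1537 ∷ decide 749 ∷ decide 1477 ∷ decide 1537 ∷ []) ∷ []) ∷
    expand 2 (expand 6 (expand 6 (decide 749 ∷ decide 749 ∷ expand 4 (decide 89 ∷ decide 89 ∷ decide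
    14661 ∷ decide 143 ∷ decide 89 ∷ []) ∷ decide 749 ∷ []) ∷ expand 6 (decide 749 ∷ expand 5
    (decide 1289 ∷ decide 1780 ∷ decide 1269 ∷ decide 1289 ∷ decide 1289 ∷ []) ∷ decide 749 ∷ []) ∷
    expand 6 (expand 7 (decide 2207 ∷ decide 2207 ∷ decide 3663 ∷ decide 3663 ∷ decide 2207 ∷ []) ∷
    decide 749 ∷ []) ∷ expand 6 (expand 8 (decide 8098 ∷ decide 8098 ∷ decide 14589 ∷ decide 52488 ∷
    decide 14589 ∷ decide 14624 ∷ []) ∷ expand 8 (expand 4 (decide 141 ∷ decide 143 ∷ decide 143 ∷
    decide 14678 ∷ decide 143 ∷ []) ∷ decide 14624 ∷ decide 14624 ∷ expand 9 (decide 34263 ∷ decide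
    34263 ∷ decide 34263 ∷ decide 53217 ∷ decide 34263 ∷ []) ∷ decide 14624 ∷ expand 9 (expand 9
    (decide 34263 ∷ decide 34263 ∷ decide 34263 ∷ decide 34342 ∷ decide 34263 ∷ []) ∷ expand 9
    (decide 34263 ∷ decide 34263 ∷ decide 34342 ∷ decide 34263 ∷ []) ∷ expand 9 (decide 34263 ∷
    decide 34342 ∷ decide 34263 ∷ []) ∷ expand 9 (decide 34342 ∷ decide 34263 ∷ []) ∷ expand 9
    (expand 11 (decide 394409 ∷ decide 394409 ∷ decide 394409 ∷ decide 394409 ∷ decide 1417176 ∷
    decide 394389 ∷ decide 394409 ∷ []) ∷ expand 11 (decide 394409 ∷ decide 394409 ∷ decide 394409 ∷
    decide 394409 ∷ decide 394409 ∷ decide 394409 ∷ decide 394409 ∷ []) ∷ []) ∷ expand 9 (decide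
    34263 ∷ []) ∷ []) ∷ []) ∷ []) ∷ expand 6 (decide 749 ∷ []) ∷ []) ∷ []) ∷ []) ∷ []) ∷ []) ∷
    expand 1 (expand 3 (expand 3 (decide 35 ∷ expand 4 (expand 4 (decide 150 ∷ expand 5 (decide 1944
    ∷ decide 642 ∷ decide 350 ∷ []) ∷ decide 89 ∷ []) ∷ expand 4 (decide 651 ∷ decide 705 ∷ []) ∷
    expand 4 (expand 2 (decide 47 ∷ decide 47 ∷ decide 47 ∷ decide 47 ∷ decide 53 ∷ []) ∷ expand 2
    (decide 47 ∷ decide 47 ∷ decide 53 ∷ decide 47 ∷ decide 53 ∷ []) ∷ []) ∷ expand 4 (decide 89 ∷
    []) ∷ []) ∷ decide 35 ∷ []) ∷ expand 3 (expand 4 (decide 89 ∷ decide 141 ∷ decide 141 ∷ decide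
    89 ∷ []) ∷ decide 35 ∷ []) ∷ expand 3 (expand 5 (expand 6 (decide 505 ∷ decide 1515 ∷ decide
    1515 ∷ decide 2001 ∷ []) ∷ decide 543 ∷ decide 1944 ∷ decide 543 ∷ expand 6 (decide 2001 ∷
    decide 1515 ∷ decide 1269 ∷ decide 1515 ∷ decide 2001 ∷ []) ∷ []) ∷ expand 4 (expand 4 (decide
    705 ∷ decide 89 ∷ expand 2 (decide 101 ∷ decide 107 ∷ decide 101 ∷ decide 101 ∷ decide 107 ∷ [])
    ∷ decide 89 ∷ []) ∷ expand 4 (expand 6 (decide 1269 ∷ decide 952 ∷ decide 1269 ∷ []) ∷ decide
    651 ∷ decide 705 ∷ []) ∷ expand 4 (expand 6 (expand 2 (decide 749 ∷ decide 749 ∷ decide 749 ∷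
    decide 749 ∷ []) ∷ decide 1269 ∷ decide 5265 ∷ expand 5 (decide 1844 ∷ decide 4860 ∷ decide
    13608 ∷ decide 1438 ∷ decide 1844 ∷ []) ∷ decide 952 ∷ []) ∷ decide 89 ∷ []) ∷ expand 4 (expand
    7 (expand 2 (decide 505 ∷ decide 2402 ∷ decide 4393 ∷ decide 4393 ∷ decide 2402 ∷ []) ∷ decide
    4860 ∷ expand 5 (decide 5079 ∷ decide 1755 ∷ decide 13608 ∷ decide 5079 ∷ decide 5079 ∷ []) ∷
    decide 17496 ∷ decide 4539 ∷ expand 5 (decide 5079 ∷ decide 5079 ∷ decide 13608 ∷ decide 5079 ∷
    decide 5079 ∷ decide 5079 ∷ []) ∷ []) ∷ expand 5 (expand 7 (decide 505 ∷ decide 5079 ∷ decide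
    5079 ∷ decide 5079 ∷ decide 5079 ∷ []) ∷ expand 6 (decide 1269 ∷ decide 1971 ∷ decide 1269 ∷
    decide 1971 ∷ decide 1269 ∷ []) ∷ decide 4860 ∷ expand 7 (decide 5079 ∷ expand 6 (expand 2
    (decide 5088 ∷ decide 1289 ∷ decide 1289 ∷ []) ∷ decide 14391 ∷ decide 5867 ∷ decide 5867 ∷ [])
    ∷ decide 15471 ∷ decide 5079 ∷ decide 5079 ∷ []) ∷ expand 7 (decide 5079 ∷ decide 5079 ∷ decide
    5079 ∷ decide 43740 ∷ decide 5079 ∷ decide 5079 ∷ []) ∷ expand 7 (decide 5079 ∷ decide 5079 ∷
    decide 5079 ∷ decide 5079 ∷ decide 5079 ∷ decide 5079 ∷ []) ∷ []) ∷ []) ∷ expand 4 (decide 89 ∷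
    []) ∷ []) ∷ []) ∷ expand 3 (decide 35 ∷ []) ∷ []) ∷ []) ∷ []) ∷ []) ∷ [])

-- Every undecided vertex has type `(0 , 0)` here, so the tree branches only over the edges among
-- the vertices already named.
cert₀₀ : Cert
cert₀₀ =
  expand 0 (expand 0 (expand 0 (expand 1 (expand 1 (expand 2 (decide 17 ∷ decide 17 ∷ []) ∷ expand 2
    (decide 17 ∷ decide 17 ∷ decide 17 ∷ []) ∷ []) ∷ expand 1 (expand 3 (decide 35 ∷ decide 35 ∷
    decide 35 ∷ []) ∷ []) ∷ expand 1 (expand 2 (expand 2 (expand 3 (decide 47 ∷ decide 47 ∷ decide
    47 ∷ []) ∷ expand 3 (decide 47 ∷ decide 47 ∷ decide 47 ∷ []) ∷ expand 3 (decide 47 ∷ decide 47 ∷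
    decide 47 ∷ decide 47 ∷ []) ∷ []) ∷ expand 2 (expand 4 (decide 104 ∷ decide 573 ∷ expand 5
    (decide 266 ∷ decide 420 ∷ decide 428 ∷ []) ∷ []) ∷ expand 5 (expand 5 (decide 573 ∷ decide 260
    ∷ decide 260 ∷ []) ∷ expand 5 (decide 411 ∷ decide 411 ∷ []) ∷ expand 5 (expand 3 (expand 3
    (decide 128 ∷ decide 134 ∷ decide 278 ∷ []) ∷ decide 752 ∷ expand 3 (expand 7 (decide 420 ∷
    decide 5589 ∷ decide 2252 ∷ decide 2252 ∷ []) ∷ []) ∷ expand 3 (decide 278 ∷ []) ∷ []) ∷ []) ∷
    expand 5 (decide 260 ∷ []) ∷ []) ∷ []) ∷ expand 2 (expand 4 (expand 4 (decide 573 ∷ decide 98 ∷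
    decide 98 ∷ []) ∷ expand 4 (decide 573 ∷ decide 573 ∷ []) ∷ expand 4 (expand 3 (expand 3 (decide
    290 ∷ decide 296 ∷ decide 116 ∷ []) ∷ decide 752 ∷ expand 3 (expand 7 (decide 582 ∷ decide 5265
    ∷ decide 2252 ∷ decide 2252 ∷ []) ∷ []) ∷ expand 3 (decide 116 ∷ []) ∷ []) ∷ []) ∷ expand 4
    (decide 98 ∷ []) ∷ []) ∷ []) ∷ expand 2 (expand 4 (expand 4 (decide 98 ∷ expand 5 (expand 5
    (decide 438 ∷ decide 464 ∷ decide 260 ∷ []) ∷ decide 898 ∷ expand 5 (expand 7 (decide 146 ∷
    decide 5121 ∷ decide 2760 ∷ decide 2760 ∷ []) ∷ []) ∷ expand 5 (decide 260 ∷ []) ∷ []) ∷ expand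
    5 (expand 5 (decide 464 ∷ decide 438 ∷ decide 260 ∷ []) ∷ expand 5 (decide 4872 ∷ expand 6
    (decide 146 ∷ decide 5121 ∷ decide 1302 ∷ decide 1302 ∷ []) ∷ []) ∷ decide 2356 ∷ expand 5
    (decide 260 ∷ []) ∷ []) ∷ decide 98 ∷ []) ∷ expand 4 (expand 5 (decide 411 ∷ decide 411 ∷ decide
    411 ∷ decide 411 ∷ []) ∷ expand 5 (decide 411 ∷ decide 411 ∷ decide 411 ∷ decide 411 ∷ []) ∷
    decide 98 ∷ []) ∷ expand 4 (expand 3 (expand 3 (decide 788 ∷ decide 2246 ∷ decide 116 ∷ []) ∷
    decide 1558 ∷ decide 4474 ∷ expand 3 (decide 116 ∷ []) ∷ []) ∷ expand 7 (expand 7 (expand 5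
    (decide 4887 ∷ decide 4636 ∷ decide 2760 ∷ decide 2760 ∷ []) ∷ decide 5121 ∷ decide 2210 ∷
    decide 2210 ∷ []) ∷ expand 7 (decide 5121 ∷ expand 3 (expand 3 (decide 308 ∷ decide 2728 ∷
    decide 116 ∷ []) ∷ expand 3 (decide 1594 ∷ decide 2234 ∷ []) ∷ expand 3 (expand 9 (expand 9
    (decide 47165 ∷ decide 19748 ∷ []) ∷ expand 9 (decide 19742 ∷ []) ∷ expand 9 (decide 19742 ∷ [])
    ∷ []) ∷ []) ∷ expand 3 (decide 116 ∷ []) ∷ []) ∷ expand 5 (decide 2760 ∷ decide 1956 ∷ decide
    2760 ∷ decide 2760 ∷ decide 2760 ∷ []) ∷ []) ∷ expand 7 (decide 3663 ∷ decide 3663 ∷ []) ∷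
    expand 7 (decide 2210 ∷ []) ∷ expand 7 (decide 2210 ∷ []) ∷ []) ∷ []) ∷ expand 4 (expand 6
    (expand 6 (expand 5 (decide 1971 ∷ decide 1720 ∷ decide 1302 ∷ decide 1302 ∷ []) ∷ decide 5121 ∷
    decide 752 ∷ decide 752 ∷ []) ∷ expand 6 (decide 5121 ∷ expand 3 (expand 3 (decide 308 ∷ decide
    1270 ∷ decide 116 ∷ []) ∷ expand 3 (decide 4510 ∷ decide 776 ∷ []) ∷ expand 3 (expand 9 (expand
    9 (decide 48623 ∷ decide 19748 ∷ []) ∷ expand 9 (decide 19742 ∷ []) ∷ expand 9 (decide 19742 ∷
    []) ∷ []) ∷ []) ∷ expand 3 (decide 116 ∷ []) ∷ []) ∷ expand 5 (decide 1302 ∷ decide 4872 ∷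
    decide 1302 ∷ decide 1302 ∷ decide 1302 ∷ []) ∷ []) ∷ expand 6 (decide 5121 ∷ decide 5121 ∷ [])
    ∷ expand 6 (decide 752 ∷ []) ∷ expand 6 (decide 752 ∷ []) ∷ []) ∷ []) ∷ expand 4 (decide 98 ∷
    []) ∷ []) ∷ []) ∷ []) ∷ []) ∷ []) ∷ []) ∷ []) ∷ [])

-- Vertices of the first four types have no undecided neighbour and are decided alone, with
-- unchanged potential.
phases : List (Type × Cert)
phases =
    ((3 , 0) , decide 1) ∷ ((2 , 1) , decide 2) ∷ ((1 , 2) , decide 2) ∷ ((0 , 3) , decide 1)
  ∷ ((1 , 1) , cert₁₁) ∷ ((0 , 2) , cert₀₂) ∷ ((2 , 0) , cert₂₀) ∷ ((0 , 1) , cert₀₁)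
  ∷ ((1 , 0) , cert₁₀) ∷ []

phases-certified : Phases phases
phases-certified = toWitness {a? = phases? phases} tt

cert₀₀-certified : Certified 15 ((0 , 0) ∷ []) cert₀₀ (0 , 0)
cert₀₀-certified = toWitness {a? = certified? 15 ((0 , 0) ∷ []) cert₀₀ (0 , 0)} tt

-- The bounds by 4 make this a finite check for `allUpTo?`, covering every type that occurs in a
-- cubic graph.
phases-complete : ∀ {s} → s < 4 → ∀ {t} → t < 4 → s + t ≤ 3 → (s , t) ∈ map proj₁ phases ++ (0 , 0) ∷ []
phases-complete = toWitness
  {a? = allUpTo? (λ s → allUpTo? (λ t → (s + t ≤? 3)
          →-dec ((s , t) Pair∈.∈? (map proj₁ phases ++ (0 , 0) ∷ []))) 4) 4} tt

theorem5 : (n : ℕ) (G : Graph n) → Cubic G →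
    ∃[ S ] (IsRestrainedDominating G S × 5 * ∣ S ∣ ≤ 2 * n)
theorem5 n G cubic = finished⇒bound finished
  where open Search G cubic phases phases-certified cert₀₀ cert₀₀-certified phases-complete
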